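{- Let $T$ be a tree on $n\ge 3$ vertices with diameter $d$. Then the peak location of the sequence of normalized coefficients $d_0(T),d_1(T),\dots,d_{n-2}(T)$ is at least $\left\lfloor\frac{n-2}{1+d}\right\rfloor$.
   Context: A tree is a finite simple undirected connected graph without cycles; its diameter $d$ is the number of edges in a longest path in the tree. The distance matrix $\mathcal{D}(T)$ is indexed by the vertices of $T$, with $(i,j)$-entry equal to the length of a shortest path between $v_i$ and $v_j$. $\delta_k(T)$ denotes the coefficient of $x^k$ in $\det(\mathcal{D}(T)-xI)$, and for $0\le k\le n-2$ the normalized coefficients are $d_k(T)=\frac{1}{2^{n-2}}2^k|\delta_k(T)|$ (not to be confused with the diameter $d$). A sequence $a_0,\dots,a_m$ of real numbers is unimodal if there is a $k$ such that $a_{i-1}\le a_i$ for $i\le k$ and $a_i\ge a_{i+1}$ for $i\ge k$ (for all indices for which these make sense). The sequence $d_0(T),\dots,d_{n-2}(T)$ is unimodal for every tree $T$. A peak location of a unimodal sequence is such an index $k$, equivalently an index at which the maximum of the sequence is attained; "the peak location is at least $j$" means that every such $k$ satisfies $k\ge j$. -}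

module Defs where

open import Algebra.Bundles.Raw using (RawRing)
import Algebra.Definitions.RawMonoid as RawMonoidDefs
open import Data.Bool.Base using (if_then_else_)
open import Data.Fin.Base as Fin using (Fin; zero; suc; inject₁; punchIn; toℕ)
open import Data.Fin.Properties using (any?; _≟_)
open import Data.Integer.Base as ℤ using (ℤ; +_; 0ℤ; 1ℤ; -1ℤ; ∣_∣)
open import Data.List.Base as List using (List; []; _∷_)
open import Data.Nat.Base as ℕ using (ℕ; zero; suc; _≤_; z≤n; s≤s; _∸_)
open import Data.Nat.Properties using (m^n≢0)
open import Data.Product.Base using (∃; _×_; _,_; proj₁)
open import Data.Rational.Base as ℚ using (ℚ)
open import Data.Vec.Base using (Vec; []; _∷_; head; last)
import Data.Vec.Relation.Unary.AllPairs as AllPairs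
open import Data.Vec.Relation.Unary.Linked using (Linked; linked?)
open import Data.Vec.Relation.Unary.Unique.Propositional using (Unique)
open import Function.Base using (_∘_)
open import Level using (0ℓ)
open import Relation.Binary.Core using (Rel)
open import Relation.Binary.Definitions using (Symmetric; Irreflexive)
  renaming (Decidable to Decidable₂)
open import Relation.Binary.PropositionalEquality.Core using (_≡_)
open import Relation.Nullary.Decidable
  using (Dec; yes; no; does; map′; _×-dec_; ¬?)
open import Relation.Nullary.Negation using (¬_; contradiction)
open import Relation.Unary using (Pred; Decidable)

record SimpleGraph (n : ℕ) : Set₁ where
  field
    Adj        : Rel (Fin n) 0ℓ
    adj?       : Decidable₂ Adj
    adj-sym    : Symmetric Adj
    adj-irrefl : Irreflexive _≡_ Adj

module _ {n : ℕ} (G : SimpleGraph n) where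
  open SimpleGraph G

  IsPath : (i j : Fin n) → ∀ {ℓ} → Vec (Fin n) (suc ℓ) → Set
  IsPath i j vs = head vs ≡ i × last vs ≡ j × Unique vs × Linked Adj vs

  -- A path with ℓ edges visits ℓ + 1 vertices.
  Path : (i j : Fin n) → ℕ → Set
  Path i j ℓ = ∃ λ (vs : Vec (Fin n) (suc ℓ)) → IsPath i j vs

  -- The first vertex is not repeated at the end of vs.
  Cycle : Set
  Cycle = ∃ λ m → ∃ λ (vs : Vec (Fin n) (3 ℕ.+ m)) →
    Unique vs × Linked Adj vs × Adj (last vs) (head vs)

  IsDistance : (i j : Fin n) → ℕ → Set
  IsDistance i j ℓ = Path i j ℓ × (∀ m → Path i j m → ℓ ≤ m)

  IsDiameter : ℕ → Set
  IsDiameter d = (∃ λ i → ∃ λ j → Path i j d)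
               × (∀ i j ℓ → Path i j ℓ → ℓ ≤ d)

record Tree (n : ℕ) : Set₁ where
  field
    graph     : SimpleGraph n
    connected : ∀ i j → ∃ λ ℓ → Path graph i j ℓ
    acyclic   : ¬ Cycle graph

  open SimpleGraph graph public

anyVec? : ∀ {n p} k {P : Pred (Vec (Fin n) k) p} → Decidable P → Dec (∃ P)
anyVec? zero    P? = map′ ([] ,_) (λ { ([] , p) → p }) (P? [])
anyVec? (suc k) P? =
  map′ (λ { (i , vs , p) → i ∷ vs , p }) (λ { (i ∷ vs , p) → i , vs , p })
       (any? λ i → anyVec? k λ vs → P? (i ∷ vs))

path? : ∀ {n} (G : SimpleGraph n) i j → Decidable (Path G i j)
path? G i j ℓ = anyVec? (suc ℓ) λ vs →
  head vs ≟ i ×-dec last vs ≟ j ×-dec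
  AllPairs.allPairs? (λ u v → ¬? (u ≟ v)) vs ×-dec
  linked? (SimpleGraph.adj? G) vs

least : ∀ {p} {P : Pred ℕ p} → Decidable P → ∀ n → P n →
        ∃ λ m → P m × (∀ k → P k → m ≤ k)
least P? zero    p = zero , p , λ _ _ → z≤n
least P? (suc n) p with P? zero
... | yes p₀ = zero , p₀ , λ _ _ → z≤n
... | no ¬p₀ with least (P? ∘ suc) n p
...   | m , pm , m≤ = suc m , pm , λ
        { zero    p₀ → contradiction p₀ ¬p₀
        ; (suc k) pk → s≤s (m≤ k pk)
        }

module _ {n : ℕ} (T : Tree n) where
  open Tree T

  shortestPath : ∀ i j → ∃ (IsDistance graph i j)
  shortestPath i j with connected i j
  ... | ℓ , p = least (path? graph i j) ℓ p

  distance : Fin n → Fin n → ℕ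
  distance i j = proj₁ (shortestPath i j)

Matrix : Set → ℕ → Set
Matrix A n = Fin n → Fin n → A

module _ (R : RawRing 0ℓ 0ℓ) where
  open RawRing R
  open RawMonoidDefs +-rawMonoid using (sum)

  alternate : ∀ {n} → Fin n → Carrier → Carrier
  alternate zero    x = x
  alternate (suc j) x = - alternate j x

  -- Laplace expansion along the first row; alternate j x is (-1)^j x.
  det : ∀ {n} → Matrix Carrier n → Carrier
  det {zero}  M = 1#
  det {suc n} M = sum λ j →
    alternate j (M zero j * det λ k l → M (suc k) (punchIn j l))

-- a₀ ∷ a₁ ∷ a₂ ∷ … represents a₀ + a₁x + a₂x² + …; trailing zeros are
-- allowed, so equality is equality of all coefficients.
Poly : Set
Poly = List ℤ

coeff : Poly → ℕ → ℤ
coeff []      k       = 0ℤ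
coeff (a ∷ p) zero    = a
coeff (a ∷ p) (suc k) = coeff p k

infixl 6 _+ₚ_
infixl 7 _*ₚ_

_+ₚ_ : Poly → Poly → Poly
[]      +ₚ q       = q
(a ∷ p) +ₚ []      = a ∷ p
(a ∷ p) +ₚ (b ∷ q) = a ℤ.+ b ∷ p +ₚ q

_*ₚ_ : Poly → Poly → Poly
[]      *ₚ q = []
(a ∷ p) *ₚ q = List.map (a ℤ.*_) q +ₚ (0ℤ ∷ p *ₚ q)

polyRing : RawRing 0ℓ 0ℓ
polyRing = record
  { Carrier = Poly
  ; _≈_     = λ p q → ∀ k → coeff p k ≡ coeff q k
  ; _+_     = _+ₚ_
  ; _*_     = _*ₚ_
  ; -_      = List.map (λ a → ℤ.- a)
  ; 0#      = []
  ; 1#      = 1ℤ ∷ []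
  }

-- det (D - xI), where the entry at (i, j) is D i j - [i = j] x.
charPoly : ∀ {n} → Matrix ℤ n → Poly
charPoly D = det polyRing λ i j →
  D i j ∷ (if does (i ≟ j) then -1ℤ else 0ℤ) ∷ []

module _ {n : ℕ} (T : Tree n) where

  distanceMatrix : Matrix ℤ n
  distanceMatrix i j = + distance T i j

  δ : ℕ → ℤ
  δ k = coeff (charPoly distanceMatrix) k

  -- The entries are d_0, …, d_{n-2} when n ≥ 2.
  normalizedCoeffs : Fin (suc (n ∸ 2)) → ℚ
  normalizedCoeffs k =
    (+ (2 ℕ.^ toℕ k ℕ.* ∣ δ (toℕ k) ∣)) ℚ./ (2 ℕ.^ (n ∸ 2))
    where instance _ = m^n≢0 2 (n ∸ 2)

IsPeak : ∀ {m} → (Fin (suc m) → ℚ) → Fin (suc m) → Set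
IsPeak {m} a k =
    (∀ (i : Fin m) → suc i Fin.≤ k → a (inject₁ i) ℚ.≤ a (suc i))
  × (∀ (i : Fin m) → k Fin.≤ inject₁ i → a (inject₁ i) ℚ.≥ a (suc i))

{-# OPTIONS --safe #-}

-- Let D be the distance matrix of the tree and L its Laplacian.  Among the
-- neighbours of i exactly one is closer to j ≠ i and the others are farther,
-- so (L D)ᵢⱼ = 2 - deg i - 2 [i = j].  For Σ x = 0 and y = D x this gives
-- L y = -2 x and 4 (x · D x) = - Σ (yᵢ - yᵤ)² over ordered pairs of adjacent
-- vertices, hence D and its principal submatrices A are strictly negative
-- definite on the hyperplane Σ x = 0.  Since Aᵢᵢ = 0, it follows that
-- y · A y ≤ 0 whenever (A y)ᵢ = 0.  Applied to rows of cofactors, this shows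
-- that the signs of the principal minors alternate with their size; applied
-- to combinations of such a row with the vector 1, it bounds the minors of
-- A[-i] from below in terms of det A and the row sums, and summing over i
-- gives (m - 2) |det A| ≤ d Σᵢ |det A[-i]| for A of size m.  As the derivative
-- of det (A - xI) is - Σᵢ det (A[-i] - xI), induction on k yields
-- (n - k - 2) |δₖ| ≤ d (k + 1) |δₖ₊₁|, so that |δₖ| < 2 |δₖ₊₁| as long as
-- (k + 1) (d + 1) ≤ n - 2.

module Submission where

open import Algebra.Bundles using (CommutativeRing)
open import Algebra.Bundles.Raw using (RawRing)
import Algebra.Properties.Ring as RingProperties
import Algebra.Properties.Semiring.Sum as SemiringSum
open import Data.Bool.Base using (if_then_else_)
open import Data.Empty using (⊥)
open import Data.Fin.Base as Fin using (Fin; zero; suc; toℕ; fromℕ<; inject₁; lift; punchIn; punchOut)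
open import Data.Fin.Properties
  using (_≟_; punchIn-injective; punchIn-punchOut; punchInᵢ≢i; toℕ-fromℕ<; toℕ-inject₁)
open import Data.Integer.Base as ℤ using (ℤ; +_; 0ℤ; 1ℤ; -1ℤ)
import Data.Integer.Properties as ℤₚ
open import Data.Integer.Tactic.RingSolver using (solve-∀)
import Data.List.Base as List
open import Data.Nat.Base as ℕ using (ℕ; zero; suc; _∸_; _^_)
import Data.Nat.DivMod as ℕ
import Data.Nat.Properties as ℕₚ
open import Data.Nat.Tactic.RingSolver using () renaming (solve-∀ to solve-∀ℕ)
open import Data.Product.Base using (∃; _×_; _,_; proj₁; proj₂)
open import Data.Rational.Base as ℚ using ()
import Data.Rational.Properties as ℚₚ
import Data.Rational.Unnormalised.Base as ℚᵘ
import Data.Rational.Unnormalised.Properties as ℚᵘₚ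
open import Data.Sum.Base using (inj₁; inj₂; [_,_]′)
import Data.Vec.Functional as V
open import Data.Vec.Membership.DecPropositional using (_∈?_)
open import Data.Vec.Membership.Propositional using (_∈_)
open import Data.Vec.Relation.Unary.Any using (here; there)
open import Data.Vec.Relation.Unary.Unique.Propositional using (Unique)
open import Function.Base using (_∘_; _⟨_⟩_; id)
open import Level using (0ℓ)
open import Relation.Binary.Core using (Rel)
open import Relation.Binary.Definitions using (Symmetric)
open import Relation.Binary.PropositionalEquality as ≡
  using (_≡_; _≢_; _≗_; cong; cong₂; subst; subst₂; module ≡-Reasoning)
import Relation.Binary.Reasoning.Setoid as SetoidReasoning
open import Relation.Nullary.Decidable using (Dec; yes; no; does; dec-true; dec-false)
open import Relation.Nullary.Negation using (¬_; contradiction)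
open import Defs


-- Determinants over a commutative ring

-- A principal submatrix of a tree distance matrix is in general not the distance matrix of a tree.
-- What passes to it is the zero diagonal, strict negative definiteness on Σ x = 0, positivity off
-- the diagonal and the bound d on the entries, so the inductions run over all injections into the
-- vertex set rather than over trees. The signs of the minors are then found over ℤ, without
-- eigenvalues.
--
-- The factor m - 2 comes from convexity. With row sums rᵢ and R = Σ rᵢ, the bound on the minors
-- reads |det A[-i]| / |det A| ≥ R / rᵢ² - 2 / rᵢ. The right side lies above its tangent at the mean
-- r = R / m, where its value is m (m - 2) / R. The m tangents add up to m² (m - 2) / R, and R ≤ m²
-- d since A has m² entries. In the induction the size and k grow together, so the factor n - k - 2
-- never changes.

module Determinant (R : CommutativeRing 0ℓ 0ℓ) where
  open CommutativeRing R hiding (zero)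
  open RingProperties ring
    using (-0#≈0#; -‿involutive; -‿+-comm; -‿distribʳ-*; -1*x≈-x)
  open SemiringSum semiring
    using (sum; sum-cong-≋; ∑-distrib-+; ∑-comm; sum-remove; sum-replicate-zero; *-distribˡ-sum)
  open SetoidReasoning setoid
  open V using (_∷_)

  alt : ∀ {n} → Fin n → Carrier → Carrier
  alt = alternate rawRing

  alt-cong : ∀ {n} (j : Fin n) {x y} → x ≈ y → alt j x ≈ alt j y
  alt-cong zero    eq = eq
  alt-cong (suc j) eq = -‿cong (alt-cong j eq)

  alt-+ : ∀ {n} (j : Fin n) x y → alt j (x + y) ≈ alt j x + alt j y
  alt-+ zero    x y = refl
  alt-+ (suc j) x y = trans (-‿cong (alt-+ j x y)) (sym (-‿+-comm _ _))

  alt-* : ∀ {n} (j : Fin n) x y → alt j (x * y) ≈ x * alt j y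
  alt-* zero    x y = refl
  alt-* (suc j) x y = trans (-‿cong (alt-* j x y)) (-‿distribʳ-* _ _)

  alt-neg : ∀ {n} (j : Fin n) x → alt j (- x) ≈ - alt j x
  alt-neg zero    x = refl
  alt-neg (suc j) x = -‿cong (alt-neg j x)

  alt-0 : ∀ {n} (j : Fin n) → alt j 0# ≈ 0#
  alt-0 zero    = refl
  alt-0 (suc j) = trans (-‿cong (alt-0 j)) -0#≈0#

  alt-involutive : ∀ {n} (j : Fin n) x → alt j (alt j x) ≈ x
  alt-involutive zero    x = refl
  alt-involutive (suc j) x = begin
    - alt j (- alt j x)    ≈⟨ -‿cong (alt-neg j _) ⟩
    - - alt j (alt j x)    ≈⟨ -‿involutive _ ⟩
    alt j (alt j x)        ≈⟨ alt-involutive j x ⟩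
    x                      ∎

  alt-comm : ∀ {m n} (i : Fin m) (j : Fin n) x → alt i (alt j x) ≈ alt j (alt i x)
  alt-comm zero    j x = refl
  alt-comm (suc i) j x = trans (-‿cong (alt-comm i j x)) (sym (alt-neg j _))

  alt-sum : ∀ {m n} (i : Fin m) (f : Fin n → Carrier) → alt i (sum f) ≈ sum (λ j → alt i (f j))
  alt-sum {n = zero}  i f = alt-0 i
  alt-sum {n = suc n} i f = trans (alt-+ i _ _) (+-congˡ (alt-sum i (f ∘ suc)))

  sum-neg : ∀ {n} (f : Fin n → Carrier) → sum (λ j → - f j) ≈ - sum f
  sum-neg f = sym (alt-sum {2} (suc zero) f)

  sum-single : ∀ {n} (f : Fin n → Carrier) i → (∀ j → j ≢ i → f j ≈ 0#) → sum f ≈ f i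
  sum-single {suc n} f i f≈0 = begin
    sum f                              ≈⟨ sum-remove {i = i} f ⟩
    f i + sum (λ j → f (punchIn i j))  ≈⟨ +-congˡ (sum-cong-≋ λ j → f≈0 _ (punchInᵢ≢i i j)) ⟩
    f i + sum {n} (λ _ → 0#)           ≈⟨ +-congˡ (sum-replicate-zero n) ⟩
    f i + 0#                           ≈⟨ +-identityʳ _ ⟩
    f i                                ∎

  opaque
    altSum : ∀ {n} → (Fin n → Carrier) → Carrier
    altSum f = sum λ j → alt j (f j)

    altSum-[] : (f : Fin 0 → Carrier) → altSum f ≈ 0#
    altSum-[] f = refl

    altSum-suc : ∀ {n} (f : Fin (suc n) → Carrier) → altSum f ≈ f zero - altSum (f ∘ suc)
    altSum-suc f = +-congˡ (sum-neg (λ j → alt j (f (suc j))))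

    altSum-cong : ∀ {n} {f g : Fin n → Carrier} → (∀ j → f j ≈ g j) → altSum f ≈ altSum g
    altSum-cong f≈g = sum-cong-≋ λ j → alt-cong j (f≈g j)

    altSum-+ : ∀ {n} (f g : Fin n → Carrier) → altSum (λ j → f j + g j) ≈ altSum f + altSum g
    altSum-+ {n} f g = trans (sum-cong-≋ {n} λ j → alt-+ j (f j) (g j))
                             (∑-distrib-+ (λ j → alt j (f j)) (λ j → alt j (g j)))

    altSum-*ˡ : ∀ {n} x (f : Fin n → Carrier) → altSum (λ j → x * f j) ≈ x * altSum f
    altSum-*ˡ {n} x f = trans (sum-cong-≋ {n} λ j → alt-* j x (f j))
                              (sym (*-distribˡ-sum x (λ j → alt j (f j))))

    altSum-alt : ∀ {m n} (i : Fin m) (f : Fin n → Carrier) → altSum (λ j → alt i (f j)) ≈ alt i (altSum f)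
    altSum-alt {n = n} i f = trans (sum-cong-≋ {n} λ j → alt-comm j i (f j))
                                   (sym (alt-sum i (λ j → alt j (f j))))

    -- In `∂-det-principal` one sign comes from moving row i to the top and the other from expanding
    -- at column i; their cancellation leaves an unsigned sum of principal minors.
    altSum-alternating : ∀ {n} (f : Fin n → Carrier) → altSum (λ i → alt i (f i)) ≈ sum f
    altSum-alternating {n} f = sum-cong-≋ {n} λ i → alt-involutive i (f i)

    altSum-comm : ∀ {m n} (f : Fin m → Fin n → Carrier) →
                  altSum (λ i → altSum (f i)) ≈ altSum (λ j → altSum (λ i → f i j))
    altSum-comm f = begin
      sum (λ i → alt i (sum λ j → alt j (f i j)))  ≈⟨ sum-cong-≋ (λ i → alt-sum i (λ j → alt j (f i j))) ⟩
      sum (λ i → sum λ j → alt i (alt j (f i j)))  ≈⟨ ∑-comm (λ i j → alt i (alt j (f i j))) ⟩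
      sum (λ j → sum λ i → alt i (alt j (f i j)))  ≈⟨ sum-cong-≋ (λ j → altSum-alt j (λ i → f i j)) ⟩
      sum (λ j → alt j (sum λ i → alt i (f i j)))  ∎

    altSum-single : ∀ {n} (f : Fin n → Carrier) i → (∀ j → j ≢ i → f j ≈ 0#) → altSum f ≈ alt i (f i)
    altSum-single f i f≈0 = sum-single (λ j → alt j (f j)) i λ j j≢i →
      trans (alt-cong j (f≈0 j j≢i)) (alt-0 j)

  opaque
    Det : ∀ {n} → Matrix Carrier n → Carrier
    Det = det rawRing

    Det≡det : ∀ {n} (M : Matrix Carrier n) → Det M ≡ det rawRing M
    Det≡det M = ≡.refl

    det-[] : (M : Matrix Carrier 0) → Det M ≈ 1#
    det-[] M = refl

  opaque
    unfolding altSum Det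

    det-expand : ∀ {n} (M : Matrix Carrier (suc n)) →
                 Det M ≈ altSum λ j → M zero j * Det λ k l → M (suc k) (punchIn j l)
    det-expand M = refl

  altSum-neg : ∀ {n} (f : Fin n → Carrier) → altSum (λ j → - f j) ≈ - altSum f
  altSum-neg f = altSum-alt {2} (suc zero) f

  det-cong : ∀ {n} {M N : Matrix Carrier n} → (∀ i j → M i j ≈ N i j) → Det M ≈ Det N
  det-cong {zero}  {M} {N} M≈N = trans (det-[] M) (sym (det-[] N))
  det-cong {suc n} {M} {N} M≈N = begin
    Det M  ≈⟨ det-expand M ⟩
    _      ≈⟨ altSum-cong (λ j → *-cong (M≈N zero j) (det-cong λ k l → M≈N (suc k) (punchIn j l))) ⟩
    _      ≈⟨ det-expand N ⟨
    Det N  ∎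

  -- The two-row Laplace expansion, in which C f stands for the minor of the
  -- remaining rows in the columns listed by f.
  expand₂ : ∀ {n} (u v : Fin (suc (suc n)) → Carrier) → ((Fin n → Fin (suc (suc n))) → Carrier) → Carrier
  expand₂ u v C = altSum λ j → u j * altSum λ k → v (punchIn j k) * C (punchIn j ∘ punchIn k)

  -- Composites of `punchIn` agree only pointwise with the lists of columns wanted below, so `C` has
  -- to respect pointwise equality.
  Extensional : ∀ {m n} → ((Fin m → Fin n) → Carrier) → Set
  Extensional C = ∀ {f g} → f ≗ g → C f ≈ C g

  private
    head-terms : ∀ {n} (u v : Fin (suc (suc n)) → Carrier) → ((Fin n → Fin (suc (suc n))) → Carrier) → Carrier
    head-terms u v C = u zero * altSum λ k → v (suc k) * C (suc ∘ punchIn k)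

    tail-terms : ∀ {n} (u v : Fin (suc (suc n)) → Carrier) → ((Fin n → Fin (suc (suc n))) → Carrier) → Carrier
    tail-terms u v C = altSum λ j → u (suc j) * altSum λ k →
      v (suc (punchIn j k)) * C (punchIn (suc j) ∘ punchIn (suc k))

    -- Pairs of columns are sorted by whether column 0 goes to `u`, to `v` or to neither. The first
    -- two groups have opposite signs and are exchanged when `u` and `v` are.
    expand₂-split : ∀ {n} (u v : Fin (suc (suc n)) → Carrier) C →
                    expand₂ u v C ≈ (head-terms u v C - head-terms v u C) + tail-terms u v C
    expand₂-split u v C = begin
      expand₂ u v C                                             ≈⟨ altSum-suc _ ⟩
      head-terms u v C - altSum (λ j → u (suc j) * inner j)      ≈⟨ +-congˡ (-‿cong (altSum-cong split)) ⟩
      head-terms u v C - altSum (λ j → v zero * (u (suc j) * C (suc ∘ punchIn j)) - rest j)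
        ≈⟨ +-congˡ (-‿cong (trans (altSum-+ (λ j → v zero * (u (suc j) * C (suc ∘ punchIn j))) (λ j → - rest j))
                                  (+-cong (altSum-*ˡ (v zero) (λ j → u (suc j) * C (suc ∘ punchIn j))) (altSum-neg rest)))) ⟩
      head-terms u v C - (head-terms v u C - tail-terms u v C)  ≈⟨ +-congˡ (-‿+-comm _ _) ⟨
      head-terms u v C + (- head-terms v u C + - - tail-terms u v C)  ≈⟨ +-congˡ (+-congˡ (-‿involutive _)) ⟩
      head-terms u v C + (- head-terms v u C + tail-terms u v C)  ≈⟨ +-assoc _ _ _ ⟨
      (head-terms u v C - head-terms v u C) + tail-terms u v C  ∎
      where
      inner = λ j → altSum λ k → v (punchIn (suc j) k) * C (punchIn (suc j) ∘ punchIn k)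
      rest₀ = λ j → altSum λ k → v (suc (punchIn j k)) * C (punchIn (suc j) ∘ punchIn (suc k))
      rest = λ j → u (suc j) * rest₀ j
      split : ∀ j → u (suc j) * inner j ≈ v zero * (u (suc j) * C (suc ∘ punchIn j)) - rest j
      split j = begin
        u (suc j) * inner j                                         ≈⟨ *-congˡ (altSum-suc _) ⟩
        u (suc j) * (v zero * C (suc ∘ punchIn j) - rest₀ j)         ≈⟨ distribˡ _ _ _ ⟩
        u (suc j) * (v zero * C (suc ∘ punchIn j)) + u (suc j) * - rest₀ j
          ≈⟨ +-cong (trans (sym (*-assoc _ _ _)) (trans (*-congʳ (*-comm _ _)) (*-assoc _ _ _))) (sym (-‿distribʳ-* _ _)) ⟩
        v zero * (u (suc j) * C (suc ∘ punchIn j)) - rest j  ∎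

    swap-head : ∀ x y → x - y ≈ - (y - x)
    swap-head x y = begin
      x - y            ≈⟨ +-comm _ _ ⟩
      - y + x          ≈⟨ +-congˡ (-‿involutive x) ⟨
      - y + - - x      ≈⟨ -‿+-comm _ _ ⟩
      - (y - x)        ∎

  mutual
    -- Induction on the number of columns. In the split the bracket changes sign by itself, and the
    -- tail is again a two-row expansion, with column 0 held fixed inside `C ∘ lift 1`.
    expand₂-swap : ∀ {n} (u v : Fin (suc (suc n)) → Carrier) C → Extensional C →
                   expand₂ u v C ≈ - expand₂ v u C
    expand₂-swap u v C ext = begin
      expand₂ u v C                                               ≈⟨ expand₂-split u v C ⟩
      (head-terms u v C - head-terms v u C) + tail-terms u v C    ≈⟨ +-cong (swap-head _ _) (tail-swap u v C ext) ⟩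
      - (head-terms v u C - head-terms u v C) - tail-terms v u C  ≈⟨ -‿+-comm _ _ ⟩
      - ((head-terms v u C - head-terms u v C) + tail-terms v u C)  ≈⟨ -‿cong (expand₂-split v u C) ⟨
      - expand₂ v u C                                             ∎

    private
      tail-swap : ∀ {n} (u v : Fin (suc (suc n)) → Carrier) C → Extensional C →
                  tail-terms u v C ≈ - tail-terms v u C
      tail-swap {zero}  u v C ext = trans (vanishes u v) (trans (sym -0#≈0#) (-‿cong (sym (vanishes v u))))
        where
        vanishes : ∀ u v → tail-terms u v C ≈ 0#
        vanishes u v = begin
          tail-terms u v C  ≈⟨ altSum-single _ zero (λ { zero 0≢0 → contradiction ≡.refl 0≢0 ; (suc ()) }) ⟩
          u (suc zero) * _  ≈⟨ *-congˡ (altSum-[] _) ⟩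
          u (suc zero) * 0# ≈⟨ zeroʳ _ ⟩
          0#                ∎
      tail-swap {suc n} u v C ext = begin
        tail-terms u v C                          ≈⟨ lifted u v ⟩
        expand₂ (u ∘ suc) (v ∘ suc) (C ∘ lift 1)   ≈⟨ expand₂-swap (u ∘ suc) (v ∘ suc) (C ∘ lift 1) (ext ∘ lift-ext) ⟩
        - expand₂ (v ∘ suc) (u ∘ suc) (C ∘ lift 1) ≈⟨ -‿cong (lifted v u) ⟨
        - tail-terms v u C                        ∎
        where
        lift-ext : ∀ {f g} → f ≗ g → lift 1 f ≗ lift 1 g
        lift-ext f≗g zero    = ≡.refl
        lift-ext f≗g (suc l) = ≡.cong suc (f≗g l)
        lift-punchIn : ∀ j k → punchIn (suc j) ∘ punchIn (suc k) ≗ lift 1 (punchIn j ∘ punchIn k)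
        lift-punchIn j k zero    = ≡.refl
        lift-punchIn j k (suc l) = ≡.refl
        lifted : ∀ u v → tail-terms u v C ≈ expand₂ (u ∘ suc) (v ∘ suc) (C ∘ lift 1)
        lifted u v = altSum-cong λ j → *-congˡ (altSum-cong λ k → *-congˡ (ext (lift-punchIn j k)))

  det-swap : ∀ {n} u v (N : Fin n → Fin (suc (suc n)) → Carrier) →
             Det (u ∷ v ∷ N) ≈ - Det (v ∷ u ∷ N)
  det-swap {n} u v N = trans (expand u v) (trans swapped (-‿cong (sym (expand v u))))
    where
    C : (Fin n → Fin (suc (suc n))) → Carrier
    C f = Det λ k l → N k (f l)
    expand : ∀ u v → Det (u ∷ v ∷ N) ≈ expand₂ u v C
    expand u v = trans (det-expand _) (altSum-cong λ j → *-congˡ (det-expand _))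
    swapped = expand₂-swap u v C (λ f≗g → det-cong λ k l → reflexive (≡.cong (N k) (f≗g l)))

  ∷-cong : ∀ {m n} {u v : Fin n → Carrier} {M N : Fin m → Fin n → Carrier} →
           (∀ j → u j ≈ v j) → (∀ i j → M i j ≈ N i j) →
           ∀ i j → (u ∷ M) i j ≈ (v ∷ N) i j
  ∷-cong u≈v M≈N zero    = u≈v
  ∷-cong u≈v M≈N (suc i) = M≈N i

  head-tail : ∀ {m n} (M : Fin (suc m) → Fin n → Carrier) i j → M i j ≈ (M zero ∷ M ∘ suc) i j
  head-tail M zero    j = refl
  head-tail M (suc i) j = refl

  mutual
    -- Row i travels to the top past i rows, each passage costing a sign. Below a fixed first row,
    -- `det-pull₂` achieves this by expanding along that row and pulling inside every minor.
    det-pull : ∀ {n} (M : Matrix Carrier (suc n)) i → Det M ≈ alt i (Det (M i ∷ M ∘ punchIn i))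
    det-pull         M zero    = det-cong (head-tail M)
    det-pull {suc n} M (suc i) = begin
      Det M                                                  ≈⟨ det-cong (head-tail M) ⟩
      Det (M zero ∷ M ∘ suc)                                 ≈⟨ det-pull₂ (M zero) (M ∘ suc) i ⟩
      alt i (Det (M zero ∷ M (suc i) ∷ M ∘ suc ∘ punchIn i))  ≈⟨ alt-cong i (det-swap (M zero) (M (suc i)) _) ⟩
      alt i (- Det (M (suc i) ∷ M zero ∷ M ∘ suc ∘ punchIn i)) ≈⟨ alt-neg i _ ⟩
      - alt i (Det (M (suc i) ∷ M zero ∷ M ∘ suc ∘ punchIn i))
        ≈⟨ -‿cong (alt-cong i (det-cong (∷-cong (λ _ → refl) rows))) ⟩
      - alt i (Det (M (suc i) ∷ M ∘ punchIn (suc i)))         ∎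
      where
      rows : ∀ k l → (M zero ∷ M ∘ suc ∘ punchIn i) k l ≈ M (punchIn (suc i) k) l
      rows zero    l = refl
      rows (suc k) l = refl

    det-pull₂ : ∀ {n} u (N : Fin (suc n) → Fin (suc (suc n)) → Carrier) i →
                Det (u ∷ N) ≈ alt i (Det (u ∷ N i ∷ N ∘ punchIn i))
    det-pull₂ u N i = begin
      Det (u ∷ N)  ≈⟨ det-expand _ ⟩
      altSum (λ j → u j * Det (λ k l → N k (punchIn j l)))
        ≈⟨ altSum-cong (λ j → *-congˡ (trans (det-pull (λ k l → N k (punchIn j l)) i) (alt-cong i (det-cong (cols j))))) ⟩
      altSum (λ j → u j * alt i (Det (λ k l → (N i ∷ N ∘ punchIn i) k (punchIn j l))))
        ≈⟨ altSum-cong (λ j → alt-* i _ _) ⟨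
      altSum (λ j → alt i (u j * Det (λ k l → (N i ∷ N ∘ punchIn i) k (punchIn j l))))
        ≈⟨ altSum-alt i (λ j → u j * Det (λ k l → (N i ∷ N ∘ punchIn i) k (punchIn j l))) ⟩
      alt i (altSum λ j → u j * Det (λ k l → (N i ∷ N ∘ punchIn i) k (punchIn j l)))
        ≈⟨ alt-cong i (det-expand _) ⟨
      alt i (Det (u ∷ N i ∷ N ∘ punchIn i))  ∎
      where
      cols : ∀ j k l → ((λ l → N i (punchIn j l)) ∷ (λ k l → N (punchIn i k) (punchIn j l))) k l
                     ≈ (N i ∷ N ∘ punchIn i) k (punchIn j l)
      cols j zero    l = refl
      cols j (suc k) l = refl

  -- The equal row is pulled next to `u` and the two are swapped. Over a general commutative ring
  -- only x = -x follows; over ℤ this gives 0.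
  det-repeated : ∀ {n} u (N : Fin (suc n) → Fin (suc (suc n)) → Carrier) k →
                 (∀ j → N k j ≈ u j) → Det (u ∷ N) ≈ - Det (u ∷ N)
  det-repeated u N k Nk≈u = begin
    Det (u ∷ N)                                ≈⟨ det-pull₂ u N k ⟩
    alt k (Det (u ∷ N k ∷ N ∘ punchIn k))       ≈⟨ alt-cong k (det-swap u (N k) _) ⟩
    alt k (- Det (N k ∷ u ∷ N ∘ punchIn k))     ≈⟨ alt-neg k _ ⟩
    - alt k (Det (N k ∷ u ∷ N ∘ punchIn k))
      ≈⟨ -‿cong (alt-cong k (det-cong (∷-cong Nk≈u (∷-cong (λ j → sym (Nk≈u j)) (λ _ _ → refl))))) ⟩
    - alt k (Det (u ∷ N k ∷ N ∘ punchIn k))     ≈⟨ -‿cong (det-pull₂ u N k) ⟨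
    - Det (u ∷ N)                              ∎

  det-unitRow : ∀ {n} (u : Fin (suc n) → Carrier) N i → (∀ j → j ≢ i → u j ≈ 0#) →
                Det (u ∷ N) ≈ alt i (u i * Det (λ k l → N k (punchIn i l)))
  det-unitRow u N i u≈0 = trans (det-expand _) (altSum-single _ i λ j j≢i →
    trans (*-congʳ (u≈0 j j≢i)) (zeroˡ _))

  cofactor : ∀ {n} → Matrix Carrier (suc n) → Matrix Carrier (suc n)
  cofactor A i j = alt i (alt j (Det λ k l → A (punchIn i k) (punchIn j l)))

  opaque
    unfolding altSum

    -- Pairing with the i-th cofactor row puts `u` in place of row i, up to moving it there. For `u`
    -- equal to row i this yields the determinant, for another row a determinant with a repeated
    -- row.
    cofactor-expand : ∀ {n} (A : Matrix Carrier (suc n)) i (u : Fin (suc n) → Carrier) →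
                      sum (λ j → u j * cofactor A i j) ≈ alt i (Det (u ∷ A ∘ punchIn i))
    cofactor-expand {n} A i u = begin
      sum (λ j → u j * cofactor A i j)
        ≈⟨ sum-cong-≋ {suc n} (λ j → trans (sym (alt-* i (u j) (alt j (minor j)))) (alt-cong i (sym (alt-* j (u j) (minor j))))) ⟩
      sum (λ j → alt i (alt j (u j * Det λ k l → A (punchIn i k) (punchIn j l))))
        ≈⟨ alt-sum i (λ j → alt j (u j * Det λ k l → A (punchIn i k) (punchIn j l))) ⟨
      alt i (altSum λ j → u j * Det λ k l → A (punchIn i k) (punchIn j l))
        ≈⟨ alt-cong i (det-expand _) ⟨
      alt i (Det (u ∷ A ∘ punchIn i))  ∎
      where
      minor : Fin (suc n) → Carrier
      minor j = Det λ k l → A (punchIn i k) (punchIn j l)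

  cofactor-diagonal : ∀ {n} (A : Matrix Carrier (suc n)) i →
                      cofactor A i i ≈ Det λ k l → A (punchIn i k) (punchIn i l)
  cofactor-diagonal A i = alt-involutive i _

  cofactor-row : ∀ {n} (A : Matrix Carrier (suc n)) i → sum (λ j → A i j * cofactor A i j) ≈ Det A
  cofactor-row A i = trans (cofactor-expand A i (A i)) (sym (det-pull A i))

  -- Derivations and determinants

  record IsDerivation (∂ : Carrier → Carrier) : Set where
    field
      ∂-cong : ∀ {x y} → x ≈ y → ∂ x ≈ ∂ y
      ∂-+    : ∀ x y → ∂ (x + y) ≈ ∂ x + ∂ y
      ∂-neg  : ∀ x → ∂ (- x) ≈ - ∂ x
      ∂-*    : ∀ x y → ∂ (x * y) ≈ ∂ x * y + x * ∂ y
      ∂-0    : ∂ 0# ≈ 0#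
      ∂-1    : ∂ 1# ≈ 0#

  module _ {∂ : Carrier → Carrier} (isDerivation : IsDerivation ∂) where
    open IsDerivation isDerivation

    ∂-alt : ∀ {n} (i : Fin n) x → ∂ (alt i x) ≈ alt i (∂ x)
    ∂-alt zero    x = refl
    ∂-alt (suc i) x = trans (∂-neg _) (-‿cong (∂-alt i x))

    ∂-sum : ∀ {n} (f : Fin n → Carrier) → ∂ (sum f) ≈ sum (λ i → ∂ (f i))
    ∂-sum {zero}  f = ∂-0
    ∂-sum {suc n} f = trans (∂-+ _ _) (+-congˡ (∂-sum (f ∘ suc)))

    opaque
      unfolding altSum

      ∂-altSum : ∀ {n} (f : Fin n → Carrier) → ∂ (altSum f) ≈ altSum (λ i → ∂ (f i))
      ∂-altSum {n} f = trans (∂-sum (λ i → alt i (f i))) (sum-cong-≋ {n} λ i → ∂-alt i (f i))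

    -- The product rule differentiates one row at a time, and that row is written on top, hence the
    -- alternating sum. In the expansion along the first row, one half of the product rule is the
    -- term i = 0; the other half differentiates the minors, by induction.
    ∂-det : ∀ {n} (M : Matrix Carrier (suc n)) →
            ∂ (Det M) ≈ altSum λ i → Det (∂ ∘ M i ∷ M ∘ punchIn i)
    ∂-det {n} M = begin
      ∂ (Det M)                                                 ≈⟨ ∂-cong (det-expand M) ⟩
      _ ≈⟨ ∂-altSum (λ j → M zero j * Det (minor j)) ⟩
      altSum (λ j → ∂ (M zero j * Det (minor j)))               ≈⟨ altSum-cong (λ j → ∂-* _ _) ⟩
      altSum (λ j → ∂ (M zero j) * Det (minor j) + M zero j * ∂ (Det (minor j)))
        ≈⟨ altSum-+ (λ j → ∂ (M zero j) * Det (minor j)) _ ⟩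
      altSum (λ j → ∂ (M zero j) * Det (minor j)) + altSum (λ j → M zero j * ∂ (Det (minor j)))
        ≈⟨ +-cong (sym (det-expand _)) (lower-rows M) ⟩
      Det (∂ ∘ M zero ∷ M ∘ suc) - altSum (λ i → Det (∂ ∘ M (suc i) ∷ M ∘ punchIn (suc i)))
        ≈⟨ altSum-suc _ ⟨
      altSum (λ i → Det (∂ ∘ M i ∷ M ∘ punchIn i))  ∎
      where
      minor : Fin (suc n) → Matrix Carrier n
      minor j k l = M (suc k) (punchIn j l)

      -- The induction hypothesis puts the differentiated row on top of each minor. Read backwards
      -- as an expansion along row 0, the result has that row in second place, and swapping the
      -- first two rows produces the minus sign.
      lower-rows : ∀ {n} (M : Matrix Carrier (suc n)) →
        altSum (λ j → M zero j * ∂ (Det λ k l → M (suc k) (punchIn j l)))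
          ≈ - altSum (λ i → Det (∂ ∘ M (suc i) ∷ M ∘ punchIn (suc i)))
      lower-rows {zero}  M = begin
        altSum (λ j → M zero j * ∂ (Det λ k l → M (suc k) (punchIn j l)))
          ≈⟨ altSum-single _ zero (λ { zero 0≢0 → contradiction ≡.refl 0≢0 ; (suc ()) }) ⟩
        M zero zero * _   ≈⟨ *-congˡ (trans (∂-cong (det-[] _)) ∂-1) ⟩
        M zero zero * 0#  ≈⟨ zeroʳ _ ⟩
        0#                ≈⟨ -0#≈0# ⟨
        - 0#              ≈⟨ -‿cong (altSum-[] _) ⟨
        - altSum _        ∎
      lower-rows {suc n} M = begin
        altSum (λ j → M zero j * ∂ (Det λ k l → M (suc k) (punchIn j l)))
          ≈⟨ altSum-cong (λ j → *-congˡ (trans (∂-det (λ k l → M (suc k) (punchIn j l)))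
                                                (altSum-cong λ i → det-cong (cols j i)))) ⟩
        altSum (λ j → M zero j * altSum (λ i → Det λ k l → rows i k (punchIn j l)))
          ≈⟨ altSum-cong (λ j → altSum-*ˡ (M zero j) (λ i → Det λ k l → rows i k (punchIn j l))) ⟨
        altSum (λ j → altSum (λ i → M zero j * Det λ k l → rows i k (punchIn j l)))
          ≈⟨ altSum-comm (λ j i → M zero j * Det λ k l → rows i k (punchIn j l)) ⟩
        altSum (λ i → altSum (λ j → M zero j * Det λ k l → rows i k (punchIn j l)))
          ≈⟨ altSum-cong (λ i → det-expand (M zero ∷ rows i)) ⟨
        altSum (λ i → Det (M zero ∷ rows i))
          ≈⟨ altSum-cong (λ i → det-swap (M zero) (∂ ∘ M (suc i)) _) ⟩
        altSum (λ i → - Det (∂ ∘ M (suc i) ∷ M zero ∷ M ∘ suc ∘ punchIn i))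
          ≈⟨ altSum-neg (λ i → Det (∂ ∘ M (suc i) ∷ M zero ∷ M ∘ suc ∘ punchIn i)) ⟩
        - altSum (λ i → Det (∂ ∘ M (suc i) ∷ M zero ∷ M ∘ suc ∘ punchIn i))
          ≈⟨ -‿cong (altSum-cong λ i → det-cong (∷-cong (λ _ → refl) (order i))) ⟩
        - altSum (λ i → Det (∂ ∘ M (suc i) ∷ M ∘ punchIn (suc i)))  ∎
        where
        rows : ∀ i → Fin (suc n) → Fin (suc (suc n)) → Carrier
        rows i = ∂ ∘ M (suc i) ∷ M ∘ suc ∘ punchIn i
        cols : ∀ j i k l →
          ((λ l → ∂ (M (suc i) (punchIn j l))) ∷ (λ k l → M (suc (punchIn i k)) (punchIn j l))) k l
            ≈ rows i k (punchIn j l)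
        cols j i zero    l = refl
        cols j i (suc k) l = refl
        order : ∀ i k l → (M zero ∷ M ∘ suc ∘ punchIn i) k l ≈ M (punchIn (suc i) k) l
        order i zero    l = refl
        order i (suc k) l = refl

    -- Row i becomes -eᵢ, and expanding along it leaves the principal minor.
    ∂-det-principal : ∀ {n} (M : Matrix Carrier (suc n)) →
      (∀ i → ∂ (M i i) ≈ - 1#) → (∀ i j → j ≢ i → ∂ (M i j) ≈ 0#) →
      ∂ (Det M) ≈ - sum λ i → Det λ k l → M (punchIn i k) (punchIn i l)
    ∂-det-principal {n} M diagonal off = begin
      ∂ (Det M)                                               ≈⟨ ∂-det M ⟩
      altSum (λ i → Det (∂ ∘ M i ∷ M ∘ punchIn i))            ≈⟨ altSum-cong (λ i → det-unitRow (∂ ∘ M i) (M ∘ punchIn i) i (off i)) ⟩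
      altSum (λ i → alt i (∂ (M i i) * minor i))              ≈⟨ altSum-alternating (λ i → ∂ (M i i) * minor i) ⟩
      sum (λ i → ∂ (M i i) * minor i)                         ≈⟨ sum-cong-≋ {suc n} (λ i → trans (*-congʳ (diagonal i)) (-1*x≈-x (minor i))) ⟩
      sum (λ i → - minor i)                                   ≈⟨ sum-neg minor ⟩
      - sum minor                                             ∎
      where
      minor : Fin (suc n) → Carrier
      minor i = Det λ k l → M (punchIn i k) (punchIn i l)

-- Integer polynomials

open List using ([]; _∷_)
open ≡ using (refl; sym; trans)
open SemiringSum ℤₚ.+-*-semiring using (sum; sum-cong-≗)
open RawRing polyRing using () renaming (_≈_ to _≈ₚ_; -_ to -ₚ_)

module _ where
  open ≡-Reasoning

  scale : ℤ → Poly → Poly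
  scale a = List.map (a ℤ.*_)

  shift : Poly → Poly
  shift p = 0ℤ ∷ p

  coeff-+ : ∀ p q k → coeff (p +ₚ q) k ≡ coeff p k ℤ.+ coeff q k
  coeff-+ []      q       k       = sym (ℤₚ.+-identityˡ _)
  coeff-+ (a ∷ p) []      k       = sym (ℤₚ.+-identityʳ _)
  coeff-+ (a ∷ p) (b ∷ q) zero    = refl
  coeff-+ (a ∷ p) (b ∷ q) (suc k) = coeff-+ p q k

  coeff-scale : ∀ a p k → coeff (scale a p) k ≡ a ℤ.* coeff p k
  coeff-scale a []      k       = sym (ℤₚ.*-zeroʳ a)
  coeff-scale a (b ∷ p) zero    = refl
  coeff-scale a (b ∷ p) (suc k) = coeff-scale a p k

  coeff-neg : ∀ p k → coeff (-ₚ p) k ≡ ℤ.- coeff p k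
  coeff-neg []      k       = refl
  coeff-neg (b ∷ p) zero    = refl
  coeff-neg (b ∷ p) (suc k) = coeff-neg p k

  coeff-* : ∀ a p q k → coeff ((a ∷ p) *ₚ q) k ≡ a ℤ.* coeff q k ℤ.+ coeff (shift (p *ₚ q)) k
  coeff-* a p q k = trans (coeff-+ (scale a q) _ k) (cong (ℤ._+ _) (coeff-scale a q k))

  shift-cong : ∀ {p q} → p ≈ₚ q → shift p ≈ₚ shift q
  shift-cong p≈q zero    = refl
  shift-cong p≈q (suc k) = p≈q k

  shift-+ : ∀ p q k → coeff (shift (p +ₚ q)) k ≡ coeff (shift p) k ℤ.+ coeff (shift q) k
  shift-+ p q zero    = refl
  shift-+ p q (suc k) = coeff-+ p q k

  shift-scale : ∀ a p k → coeff (shift (scale a p)) k ≡ a ℤ.* coeff (shift p) k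
  shift-scale a p zero    = sym (ℤₚ.*-zeroʳ a)
  shift-scale a p (suc k) = coeff-scale a p k

  +ₚ-cong : ∀ {p p′ q q′} → p ≈ₚ p′ → q ≈ₚ q′ → (p +ₚ q) ≈ₚ (p′ +ₚ q′)
  +ₚ-cong {p} {p′} {q} {q′} p≈ q≈ k = begin
    coeff (p +ₚ q) k            ≡⟨ coeff-+ p q k ⟩
    coeff p k ℤ.+ coeff q k     ≡⟨ cong₂ ℤ._+_ (p≈ k) (q≈ k) ⟩
    coeff p′ k ℤ.+ coeff q′ k   ≡⟨ coeff-+ p′ q′ k ⟨
    coeff (p′ +ₚ q′) k          ∎

  *ₚ-congˡ : ∀ p {q q′} → q ≈ₚ q′ → (p *ₚ q) ≈ₚ (p *ₚ q′)
  *ₚ-congˡ []      q≈ k = refl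
  *ₚ-congˡ (a ∷ p) {q} {q′} q≈ k = begin
    coeff ((a ∷ p) *ₚ q) k                             ≡⟨ coeff-* a p q k ⟩
    a ℤ.* coeff q k ℤ.+ coeff (shift (p *ₚ q)) k       ≡⟨ cong₂ (λ x y → a ℤ.* x ℤ.+ y) (q≈ k) (shift-cong (*ₚ-congˡ p q≈) k) ⟩
    a ℤ.* coeff q′ k ℤ.+ coeff (shift (p *ₚ q′)) k     ≡⟨ coeff-* a p q′ k ⟨
    coeff ((a ∷ p) *ₚ q′) k                            ∎

  *ₚ-zeroʳ : ∀ p → (p *ₚ []) ≈ₚ []
  *ₚ-zeroʳ []      k       = refl
  *ₚ-zeroʳ (a ∷ p) zero    = refl
  *ₚ-zeroʳ (a ∷ p) (suc k) = *ₚ-zeroʳ p k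

  -- The multiplication recurses on its left factor; commutativity needs this mirror recursion on
  -- the right one.
  *ₚ-∷ : ∀ q a p k → coeff (q *ₚ (a ∷ p)) k ≡ a ℤ.* coeff q k ℤ.+ coeff (shift (q *ₚ p)) k
  *ₚ-∷ []      a p zero    = solution a
    where
    solution : ∀ a → 0ℤ ≡ a ℤ.* 0ℤ ℤ.+ 0ℤ
    solution = solve-∀
  *ₚ-∷ []      a p (suc k) = solution a
    where
    solution : ∀ a → 0ℤ ≡ a ℤ.* 0ℤ ℤ.+ 0ℤ
    solution = solve-∀
  *ₚ-∷ (b ∷ q) a p zero    = cong (ℤ._+ 0ℤ) (ℤₚ.*-comm b a)
  *ₚ-∷ (b ∷ q) a p (suc k) = begin
    coeff ((b ∷ q) *ₚ (a ∷ p)) (suc k)                        ≡⟨ coeff-* b q (a ∷ p) (suc k) ⟩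
    b ℤ.* coeff p k ℤ.+ coeff (q *ₚ (a ∷ p)) k                ≡⟨ cong (λ x → b ℤ.* coeff p k ℤ.+ x) (*ₚ-∷ q a p k) ⟩
    b ℤ.* coeff p k ℤ.+ (a ℤ.* coeff q k ℤ.+ coeff (shift (q *ₚ p)) k)
      ≡⟨ exchange (b ℤ.* coeff p k) (a ℤ.* coeff q k) _ ⟩
    a ℤ.* coeff q k ℤ.+ (b ℤ.* coeff p k ℤ.+ coeff (shift (q *ₚ p)) k)
      ≡⟨ cong (λ x → a ℤ.* coeff q k ℤ.+ x) (coeff-* b q p k) ⟨
    a ℤ.* coeff q k ℤ.+ coeff ((b ∷ q) *ₚ p) k                ∎
    where
    exchange : ∀ x y z → x ℤ.+ (y ℤ.+ z) ≡ y ℤ.+ (x ℤ.+ z)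
    exchange = solve-∀

  *ₚ-comm : ∀ p q → (p *ₚ q) ≈ₚ (q *ₚ p)
  *ₚ-comm []      q k = sym (*ₚ-zeroʳ q k)
  *ₚ-comm (a ∷ p) q k = begin
    coeff ((a ∷ p) *ₚ q) k                        ≡⟨ coeff-* a p q k ⟩
    a ℤ.* coeff q k ℤ.+ coeff (shift (p *ₚ q)) k  ≡⟨ cong (λ x → a ℤ.* coeff q k ℤ.+ x) (shift-cong (*ₚ-comm p q) k) ⟩
    a ℤ.* coeff q k ℤ.+ coeff (shift (q *ₚ p)) k  ≡⟨ *ₚ-∷ q a p k ⟨
    coeff (q *ₚ (a ∷ p)) k                        ∎

  *ₚ-cong : ∀ {p p′ q q′} → p ≈ₚ p′ → q ≈ₚ q′ → (p *ₚ q) ≈ₚ (p′ *ₚ q′)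
  *ₚ-cong {p} {p′} {q} {q′} p≈ q≈ k = begin
    coeff (p *ₚ q) k    ≡⟨ *ₚ-congˡ p q≈ k ⟩
    coeff (p *ₚ q′) k   ≡⟨ *ₚ-comm p q′ k ⟩
    coeff (q′ *ₚ p) k   ≡⟨ *ₚ-congˡ q′ p≈ k ⟩
    coeff (q′ *ₚ p′) k  ≡⟨ *ₚ-comm q′ p′ k ⟩
    coeff (p′ *ₚ q′) k  ∎

  *ₚ-distribʳ : ∀ q p p′ k → coeff ((p +ₚ p′) *ₚ q) k ≡ coeff (p *ₚ q) k ℤ.+ coeff (p′ *ₚ q) k
  *ₚ-distribʳ q []      p′        k = sym (ℤₚ.+-identityˡ _)
  *ₚ-distribʳ q (a ∷ p) []        k = sym (ℤₚ.+-identityʳ _)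
  *ₚ-distribʳ q (a ∷ p) (a′ ∷ p′) k = begin
    coeff ((a ℤ.+ a′ ∷ p +ₚ p′) *ₚ q) k                                 ≡⟨ coeff-* (a ℤ.+ a′) (p +ₚ p′) q k ⟩
    (a ℤ.+ a′) ℤ.* coeff q k ℤ.+ coeff (shift ((p +ₚ p′) *ₚ q)) k
      ≡⟨ cong (λ x → (a ℤ.+ a′) ℤ.* coeff q k ℤ.+ x)
              (trans (shift-cong {(p +ₚ p′) *ₚ q} {p *ₚ q +ₚ p′ *ₚ q}
                        (λ k → trans (*ₚ-distribʳ q p p′ k) (sym (coeff-+ (p *ₚ q) _ k))) k)
                     (shift-+ (p *ₚ q) (p′ *ₚ q) k)) ⟩
    (a ℤ.+ a′) ℤ.* coeff q k ℤ.+ (coeff (shift (p *ₚ q)) k ℤ.+ coeff (shift (p′ *ₚ q)) k)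
      ≡⟨ regroup a a′ (coeff q k) _ _ ⟩
    (a ℤ.* coeff q k ℤ.+ coeff (shift (p *ₚ q)) k) ℤ.+ (a′ ℤ.* coeff q k ℤ.+ coeff (shift (p′ *ₚ q)) k)
      ≡⟨ cong₂ ℤ._+_ (coeff-* a p q k) (coeff-* a′ p′ q k) ⟨
    coeff ((a ∷ p) *ₚ q) k ℤ.+ coeff ((a′ ∷ p′) *ₚ q) k                 ∎
    where
    regroup : ∀ a a′ c x y → (a ℤ.+ a′) ℤ.* c ℤ.+ (x ℤ.+ y) ≡ (a ℤ.* c ℤ.+ x) ℤ.+ (a′ ℤ.* c ℤ.+ y)
    regroup = solve-∀

  scale-* : ∀ a p q → (scale a p *ₚ q) ≈ₚ scale a (p *ₚ q)
  scale-* a []      q k = refl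
  scale-* a (b ∷ p) q k = begin
    coeff (scale a (b ∷ p) *ₚ q) k                                   ≡⟨ coeff-* (a ℤ.* b) (scale a p) q k ⟩
    a ℤ.* b ℤ.* coeff q k ℤ.+ coeff (shift (scale a p *ₚ q)) k
      ≡⟨ cong (λ x → a ℤ.* b ℤ.* coeff q k ℤ.+ x)
              (trans (shift-cong (scale-* a p q) k) (shift-scale a (p *ₚ q) k)) ⟩
    a ℤ.* b ℤ.* coeff q k ℤ.+ a ℤ.* coeff (shift (p *ₚ q)) k         ≡⟨ factor a b (coeff q k) _ ⟩
    a ℤ.* (b ℤ.* coeff q k ℤ.+ coeff (shift (p *ₚ q)) k)             ≡⟨ cong (a ℤ.*_) (coeff-* b p q k) ⟨
    a ℤ.* coeff ((b ∷ p) *ₚ q) k                                     ≡⟨ coeff-scale a ((b ∷ p) *ₚ q) k ⟨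
    coeff (scale a ((b ∷ p) *ₚ q)) k                                 ∎
    where
    factor : ∀ a b c x → a ℤ.* b ℤ.* c ℤ.+ a ℤ.* x ≡ a ℤ.* (b ℤ.* c ℤ.+ x)
    factor = solve-∀

  shift-* : ∀ p q → (shift p *ₚ q) ≈ₚ shift (p *ₚ q)
  shift-* p q k = trans (coeff-* 0ℤ p q k) (ℤₚ.+-identityˡ _)

  *ₚ-assoc : ∀ p q r → (p *ₚ q *ₚ r) ≈ₚ (p *ₚ (q *ₚ r))
  *ₚ-assoc []      q r k = refl
  *ₚ-assoc (a ∷ p) q r k = begin
    coeff ((scale a q +ₚ shift (p *ₚ q)) *ₚ r) k           ≡⟨ *ₚ-distribʳ r (scale a q) _ k ⟩
    coeff (scale a q *ₚ r) k ℤ.+ coeff (shift (p *ₚ q) *ₚ r) k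
      ≡⟨ cong₂ ℤ._+_ (scale-* a q r k) (trans (shift-* (p *ₚ q) r k) (shift-cong (*ₚ-assoc p q r) k)) ⟩
    coeff (scale a (q *ₚ r)) k ℤ.+ coeff (shift (p *ₚ (q *ₚ r))) k  ≡⟨ coeff-+ (scale a (q *ₚ r)) _ k ⟨
    coeff ((a ∷ p) *ₚ (q *ₚ r)) k                          ∎

  *ₚ-identityˡ : ∀ p → ((1ℤ ∷ []) *ₚ p) ≈ₚ p
  *ₚ-identityˡ p k = trans (coeff-* 1ℤ [] p k) (trans (cong (λ x → 1ℤ ℤ.* coeff p k ℤ.+ x) (zeros k)) (unit (coeff p k)))
    where
    zeros : ∀ k → coeff (shift []) k ≡ 0ℤ
    zeros zero    = refl
    zeros (suc k) = refl
    unit : ∀ x → 1ℤ ℤ.* x ℤ.+ 0ℤ ≡ x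
    unit = solve-∀

  +ₚ-assoc : ∀ p q r → (p +ₚ q +ₚ r) ≈ₚ (p +ₚ (q +ₚ r))
  +ₚ-assoc p q r k = begin
    coeff (p +ₚ q +ₚ r) k                      ≡⟨ trans (coeff-+ (p +ₚ q) r k) (cong (ℤ._+ coeff r k) (coeff-+ p q k)) ⟩
    coeff p k ℤ.+ coeff q k ℤ.+ coeff r k      ≡⟨ ℤₚ.+-assoc (coeff p k) _ _ ⟩
    coeff p k ℤ.+ (coeff q k ℤ.+ coeff r k)    ≡⟨ trans (coeff-+ p (q +ₚ r) k) (cong (λ x → coeff p k ℤ.+ x) (coeff-+ q r k)) ⟨
    coeff (p +ₚ (q +ₚ r)) k                    ∎

  +ₚ-comm : ∀ p q → (p +ₚ q) ≈ₚ (q +ₚ p)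
  +ₚ-comm p q k = trans (coeff-+ p q k) (trans (ℤₚ.+-comm (coeff p k) _) (sym (coeff-+ q p k)))

  +ₚ-inverseˡ : ∀ p → (-ₚ p +ₚ p) ≈ₚ []
  +ₚ-inverseˡ p k = trans (coeff-+ (-ₚ p) p k)
    (trans (cong (ℤ._+ coeff p k) (coeff-neg p k)) (ℤₚ.+-inverseˡ (coeff p k)))

  *ₚ-distribʳ′ : ∀ q p p′ → ((p +ₚ p′) *ₚ q) ≈ₚ (p *ₚ q +ₚ p′ *ₚ q)
  *ₚ-distribʳ′ q p p′ k = trans (*ₚ-distribʳ q p p′ k) (sym (coeff-+ (p *ₚ q) _ k))

polyCommutativeRing : CommutativeRing 0ℓ 0ℓ
polyCommutativeRing = record
  { RawRing polyRing
  ; isCommutativeRing = record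
    { isRing = record
      { +-isAbelianGroup = record
        { isGroup = record
          { isMonoid = record
            { isSemigroup = record
              { isMagma = record
                { isEquivalence = record
                  { refl = λ k → refl ; sym = λ eq k → sym (eq k) ; trans = λ eq₁ eq₂ k → trans (eq₁ k) (eq₂ k) }
                ; ∙-cong = λ {p} {p′} {q} {q′} → +ₚ-cong {p} {p′} {q} {q′}
                }
              ; assoc = +ₚ-assoc
              }
            ; identity = (λ p k → refl) , λ p → +ₚ-comm p []
            }
          ; inverse = +ₚ-inverseˡ , λ p k → trans (+ₚ-comm p (-ₚ p) k) (+ₚ-inverseˡ p k)
          ; ⁻¹-cong = λ {p} {q} p≈q k → trans (coeff-neg p k) (trans (cong ℤ.-_ (p≈q k)) (sym (coeff-neg q k)))
          }
        ; comm = +ₚ-comm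
        }
      ; *-cong = λ {p} {p′} {q} {q′} → *ₚ-cong {p} {p′} {q} {q′}
      ; *-assoc = *ₚ-assoc
      ; *-identity = *ₚ-identityˡ , λ p k → trans (*ₚ-comm p (1ℤ ∷ []) k) (*ₚ-identityˡ p k)
      ; distrib = (λ q p p′ k → trans (*ₚ-comm q (p +ₚ p′) k) (trans (*ₚ-distribʳ′ q p p′ k)
                      (+ₚ-cong {p *ₚ q} {q *ₚ p} {p′ *ₚ q} {q *ₚ p′} (*ₚ-comm p q) (*ₚ-comm p′ q) k)))
                , *ₚ-distribʳ′
      }
    ; *-comm = *ₚ-comm
    }
  }

-- The rule (a + x p)′ = p + x p′.
derivative : Poly → Poly
derivative []      = []
derivative (a ∷ p) = p +ₚ shift (derivative p)

coeff-derivative : ∀ p k → coeff (derivative p) k ≡ + suc k ℤ.* coeff p (suc k)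
coeff-derivative []      k       = sym (ℤₚ.*-zeroʳ (+ suc k))
coeff-derivative (a ∷ p) zero    = trans (coeff-+ p _ zero) (trans (ℤₚ.+-identityʳ _) (sym (ℤₚ.*-identityˡ _)))
coeff-derivative (a ∷ p) (suc k) = trans (coeff-+ p _ (suc k))
  (trans (cong (λ x → coeff p (suc k) ℤ.+ x) (coeff-derivative p k)) (sym (ℤₚ.suc-* (+ suc k) _)))

module _ where
  open ≡-Reasoning

  -- Coefficients are compared with k + 1 split as 1 + k: the 1 accounts for the derivative of x in
  -- a + x p, and k times the coefficient of p q is the induction hypothesis for p one degree lower.
  derivative-* : ∀ p q k → coeff (derivative (p *ₚ q)) k ≡ coeff (derivative p *ₚ q +ₚ p *ₚ derivative q) k
  derivative-* []      q k = refl
  derivative-* (a ∷ p) q k = begin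
    coeff (derivative ((a ∷ p) *ₚ q)) k                                        ≡⟨ coeff-derivative ((a ∷ p) *ₚ q) k ⟩
    + suc k ℤ.* coeff ((a ∷ p) *ₚ q) (suc k)                                   ≡⟨ cong (+ suc k ℤ.*_) (coeff-* a p q (suc k)) ⟩
    + suc k ℤ.* (a ℤ.* coeff q (suc k) ℤ.+ coeff (p *ₚ q) k)                   ≡⟨ regroup (+ k) a (coeff q (suc k)) (coeff (p *ₚ q) k) ⟩
    a ℤ.* (+ suc k ℤ.* coeff q (suc k)) ℤ.+ (coeff (p *ₚ q) k ℤ.+ + k ℤ.* coeff (p *ₚ q) k)
      ≡⟨ cong₂ (λ x y → a ℤ.* x ℤ.+ (coeff (p *ₚ q) k ℤ.+ y)) (sym (coeff-derivative q k)) (inner k) ⟩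
    a ℤ.* coeff (derivative q) k ℤ.+ (coeff (p *ₚ q) k ℤ.+ (coeff (shift (derivative p *ₚ q)) k ℤ.+ coeff (shift (p *ₚ derivative q)) k))
      ≡⟨ reorder (a ℤ.* coeff (derivative q) k) (coeff (p *ₚ q) k) _ _ ⟩
    (coeff (p *ₚ q) k ℤ.+ coeff (shift (derivative p *ₚ q)) k) ℤ.+ (a ℤ.* coeff (derivative q) k ℤ.+ coeff (shift (p *ₚ derivative q)) k)
      ≡⟨ cong₂ ℤ._+_ (trans (*ₚ-distribʳ q p _ k) (cong (λ x → coeff (p *ₚ q) k ℤ.+ x) (shift-* (derivative p) q k))) (coeff-* a p (derivative q) k) ⟨
    coeff (derivative (a ∷ p) *ₚ q) k ℤ.+ coeff ((a ∷ p) *ₚ derivative q) k    ≡⟨ coeff-+ (derivative (a ∷ p) *ₚ q) _ k ⟨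
    coeff (derivative (a ∷ p) *ₚ q +ₚ (a ∷ p) *ₚ derivative q) k               ∎
    where
    regroup : ∀ k a b c → (1ℤ ℤ.+ k) ℤ.* (a ℤ.* b ℤ.+ c) ≡ a ℤ.* ((1ℤ ℤ.+ k) ℤ.* b) ℤ.+ (c ℤ.+ k ℤ.* c)
    regroup = solve-∀
    reorder : ∀ x y z w → x ℤ.+ (y ℤ.+ (z ℤ.+ w)) ≡ (y ℤ.+ z) ℤ.+ (x ℤ.+ w)
    reorder = solve-∀
    inner : ∀ k → + k ℤ.* coeff (p *ₚ q) k ≡ coeff (shift (derivative p *ₚ q)) k ℤ.+ coeff (shift (p *ₚ derivative q)) k
    inner zero    = refl
    inner (suc k) = trans (sym (coeff-derivative (p *ₚ q) k))
      (trans (derivative-* p q k) (coeff-+ (derivative p *ₚ q) _ k))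

-- Coefficients of characteristic polynomials

ℤ-rawRing : RawRing 0ℓ 0ℓ
ℤ-rawRing = CommutativeRing.rawRing ℤₚ.+-*-commutativeRing

module ℤ-Det = Determinant ℤₚ.+-*-commutativeRing
module Poly-Det = Determinant polyCommutativeRing

derivative-isDerivation : Poly-Det.IsDerivation derivative
derivative-isDerivation = record
  { ∂-cong = λ {p} {q} p≈q k → trans (coeff-derivative p k)
      (trans (cong (+ suc k ℤ.*_) (p≈q (suc k))) (sym (coeff-derivative q k)))
  ; ∂-+    = λ p q k → trans (coeff-derivative (p +ₚ q) k) (trans (cong (+ suc k ℤ.*_) (coeff-+ p q (suc k)))
      (trans (ℤₚ.*-distribˡ-+ (+ suc k) (coeff p (suc k)) (coeff q (suc k))) (sym (trans (coeff-+ (derivative p) _ k)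
        (cong₂ ℤ._+_ (coeff-derivative p k) (coeff-derivative q k))))))
  ; ∂-neg  = λ p k → trans (coeff-derivative (-ₚ p) k) (trans (cong (+ suc k ℤ.*_) (coeff-neg p (suc k)))
      (trans (sym (ℤₚ.neg-distribʳ-* (+ suc k) _)) (sym (trans (coeff-neg (derivative p) k)
        (cong ℤ.-_ (coeff-derivative p k))))))
  ; ∂-*    = derivative-*
  ; ∂-0    = λ k → refl
  ; ∂-1    = λ { zero → refl ; (suc k) → refl }
  }


module _ where
  open SemiringSum (CommutativeRing.semiring polyCommutativeRing) using () renaming (sum to sumₚ)
  open ≡-Reasoning

  coeff-sum : ∀ {n} (f : Fin n → Poly) k → coeff (sumₚ f) k ≡ sum λ i → coeff (f i) k
  coeff-sum {zero}  f k = refl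
  coeff-sum {suc n} f k = trans (coeff-+ (f zero) _ k) (cong (λ x → coeff (f zero) k ℤ.+ x) (coeff-sum (f ∘ suc) k))

  coeff₀-alternate : ∀ {n} (j : Fin n) p → coeff (alternate polyRing j p) 0 ≡ ℤ-Det.alt j (coeff p 0)
  coeff₀-alternate zero    p = refl
  coeff₀-alternate (suc j) p = trans (coeff-neg (alternate polyRing j p) 0) (cong ℤ.-_ (coeff₀-alternate j p))

  coeff₀-* : ∀ p q → coeff (p *ₚ q) 0 ≡ coeff p 0 ℤ.* coeff q 0
  coeff₀-* []      q = refl
  coeff₀-* (a ∷ p) q = trans (coeff-* a p q 0) (ℤₚ.+-identityʳ _)

  -- Evaluation at x = 0 is a ring homomorphism, so it commutes with the Laplace expansion.
  coeff₀-det : ∀ {n} (M : Matrix Poly n) →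
               coeff (det polyRing M) 0 ≡ det ℤ-rawRing λ i j → coeff (M i j) 0
  coeff₀-det {zero}  M = refl
  coeff₀-det {suc n} M = trans (coeff-sum (λ j → alternate polyRing j (M zero j *ₚ minor j)) 0) (sum-cong-≗ λ j → begin
    coeff (alternate polyRing j (M zero j *ₚ minor j)) 0             ≡⟨ coeff₀-alternate j (M zero j *ₚ minor j) ⟩
    ℤ-Det.alt j (coeff (M zero j *ₚ minor j) 0)                      ≡⟨ cong (ℤ-Det.alt j) (coeff₀-* (M zero j) (minor j)) ⟩
    ℤ-Det.alt j (coeff (M zero j) 0 ℤ.* coeff (minor j) 0)
      ≡⟨ cong (λ x → ℤ-Det.alt j (coeff (M zero j) 0 ℤ.* x)) (coeff₀-det λ k l → M (suc k) (punchIn j l)) ⟩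
    _  ∎)
    where
    minor : Fin (suc n) → Poly
    minor j = det polyRing λ k l → M (suc k) (punchIn j l)

  private
    slope : ∀ {n} → Matrix ℤ n
    slope i j = if does (i ≟ j) then -1ℤ else 0ℤ

  charPoly-zero : ∀ {n} (A : Matrix ℤ n) → coeff (charPoly A) 0 ≡ ℤ-Det.Det A
  charPoly-zero A = trans (coeff₀-det (λ i j → A i j ∷ slope i j ∷ [])) (sym (ℤ-Det.Det≡det A))

  principal : ∀ {n} {X : Set} → Matrix X (suc n) → Fin (suc n) → Matrix X n
  principal A i k l = A (punchIn i k) (punchIn i l)

  private
    slope-diagonal : ∀ {n} (i : Fin n) → slope i i ≡ -1ℤ
    slope-diagonal i rewrite dec-true (i ≟ i) refl = refl

    slope-off : ∀ {n} {i j : Fin n} → i ≢ j → slope i j ≡ 0ℤ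
    slope-off {i = i} {j} i≢j rewrite dec-false (i ≟ j) i≢j = refl

    slope-principal : ∀ {n} (i : Fin (suc n)) k l → principal slope i k l ≡ slope k l
    slope-principal i k l with k ≟ l
    ... | yes refl = slope-diagonal (punchIn i k)
    ... | no  k≢l  = slope-off (k≢l ∘ punchIn-injective i k l)

    pencil : ∀ {n} → Matrix ℤ n → Matrix Poly n
    pencil A i j = A i j ∷ slope i j ∷ []

    derivative-linear : ∀ a b → derivative (a ∷ b ∷ []) ≈ₚ (b ∷ [])
    derivative-linear a b zero          = ℤₚ.+-identityʳ b
    derivative-linear a b (suc zero)    = refl
    derivative-linear a b (suc (suc k)) = refl

  -- The factor k + 1 stays on the left because ℤ has no division; the estimates below cancel it as
  -- a positive factor.
  charPoly-suc : ∀ {n} (A : Matrix ℤ (suc n)) k →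
    + suc k ℤ.* coeff (charPoly A) (suc k) ≡ ℤ.- sum λ i → coeff (charPoly (principal A i)) k
  charPoly-suc A k = begin
    + suc k ℤ.* coeff (charPoly A) (suc k)   ≡⟨ coeff-derivative (charPoly A) k ⟨
    coeff (derivative (charPoly A)) k        ≡⟨ cong (λ p → coeff (derivative p) k) (Poly-Det.Det≡det (pencil A)) ⟨
    coeff (derivative (Poly-Det.Det (pencil A))) k
      ≡⟨ Poly-Det.∂-det-principal derivative-isDerivation (pencil A) diagonal off k ⟩
    coeff (-ₚ sumₚ λ i → Poly-Det.Det (principal (pencil A) i)) k
      ≡⟨ coeff-neg (sumₚ λ i → Poly-Det.Det (principal (pencil A) i)) k ⟩
    ℤ.- coeff (sumₚ λ i → Poly-Det.Det (principal (pencil A) i)) k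
      ≡⟨ cong ℤ.-_ (trans (coeff-sum (λ i → Poly-Det.Det (principal (pencil A) i)) k) (sum-cong-≗ minor)) ⟩
    ℤ.- (sum λ i → coeff (charPoly (principal A i)) k)  ∎
    where
    diagonal : ∀ i → derivative (pencil A i i) ≈ₚ (-ₚ (1ℤ ∷ []))
    diagonal i k = trans (derivative-linear (A i i) (slope i i) k) (cong (λ b → coeff (b ∷ []) k) (slope-diagonal i))
    off : ∀ i j → j ≢ i → derivative (pencil A i j) ≈ₚ []
    off i j j≢i zero    = trans (derivative-linear (A i j) (slope i j) zero) (slope-off (j≢i ∘ sym))
    off i j j≢i (suc k) = derivative-linear (A i j) (slope i j) (suc k)
    minor : ∀ i → coeff (Poly-Det.Det (principal (pencil A) i)) k ≡ coeff (charPoly (principal A i)) k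
    minor i = trans
      (Poly-Det.det-cong {M = principal (pencil A) i} {N = pencil (principal A i)}
        (λ m l k → cong (λ b → coeff (principal A i m l ∷ b ∷ []) k) (slope-principal i m l)) k)
      (cong (λ p → coeff p k) (Poly-Det.Det≡det (pencil (principal A i))))

  charPoly-cong : ∀ {n} {A B : Matrix ℤ n} → (∀ i j → A i j ≡ B i j) → charPoly A ≈ₚ charPoly B
  charPoly-cong {A = A} {B} A≡B k = begin
    coeff (charPoly A) k                ≡⟨ cong (λ p → coeff p k) (Poly-Det.Det≡det (pencil A)) ⟨
    coeff (Poly-Det.Det (pencil A)) k
      ≡⟨ Poly-Det.det-cong {M = pencil A} {N = pencil B} (λ i j k → cong (λ a → coeff (a ∷ slope i j ∷ []) k) (A≡B i j)) k ⟩
    coeff (Poly-Det.Det (pencil B)) k   ≡⟨ cong (λ p → coeff p k) (Poly-Det.Det≡det (pencil B)) ⟩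
    coeff (charPoly B) k                ∎

-- Distances in trees

module _ where
  open import Data.Nat.Base using (_+_; _≤_; _<_; z≤n; s≤s)
  open import Data.Vec.Base using (Vec; []; _∷_; head; last)
  open import Data.Vec.Relation.Unary.All using (All; []; _∷_)
  open import Data.Vec.Relation.Unary.AllPairs using ([]; _∷_)
  open import Data.Vec.Relation.Unary.Linked as Linked using (Linked; [-]; _∷_)

  module _ {n : ℕ} (R : Rel (Fin n) 0ℓ) where

    -- Walks may repeat vertices and therefore concatenate and reverse without side conditions;
    -- `walk⇒simple` leads back to paths.
    data Walk : ℕ → Fin n → Fin n → Set where
      []  : ∀ {i} → Walk 0 i i
      _∷_ : ∀ {ℓ i j k} → R i j → Walk ℓ j k → Walk (suc ℓ) i k

    SimpleWalk : ℕ → Fin n → Fin n → Set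
    SimpleWalk ℓ i j = ∃ λ (vs : Vec (Fin n) (suc ℓ)) → head vs ≡ i × last vs ≡ j × Unique vs × Linked R vs

  module _ {n : ℕ} {R : Rel (Fin n) 0ℓ} where

    reverse-append : Symmetric R → ∀ {a b i j k} → Walk R a i j → Walk R b i k → Walk R (a + b) j k
    reverse-append sym-R [] acc = acc
    reverse-append sym-R {b = b} {j = j} {k} (_∷_ {ℓ = ℓ} r w) acc =
      subst (λ m → Walk R m j k) (ℕₚ.+-suc ℓ b) (reverse-append sym-R w (sym-R r ∷ acc))

    reverse : Symmetric R → ∀ {ℓ i j} → Walk R ℓ i j → Walk R ℓ j i
    reverse sym-R {ℓ} {i} {j} w = subst (λ m → Walk R m j i) (ℕₚ.+-identityʳ ℓ) (reverse-append sym-R w [])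

    simple⇒walk : ∀ {ℓ i j} → SimpleWalk R ℓ i j → Walk R ℓ i j
    simple⇒walk (v ∷ []     , refl , refl , _         , _)      = []
    simple⇒walk (v ∷ w ∷ vs , refl , last≡ , (_ ∷ uniq) , r ∷ rs) =
      r ∷ simple⇒walk (w ∷ vs , refl , last≡ , uniq , rs)

    suffix : ∀ {ℓ a j} (vs : Vec (Fin n) (suc ℓ)) → a ∈ vs → last vs ≡ j → Unique vs → Linked R vs →
             ∃ λ m → m ≤ ℓ × SimpleWalk R m a j
    suffix vs@(_ ∷ _)      (here refl)  last≡ uniq       linked       = _ , ℕₚ.≤-refl , vs , refl , last≡ , uniq , linked
    suffix (_ ∷ vs@(_ ∷ _)) (there a∈vs) last≡ (_ ∷ uniq) (_ ∷ linked) =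
      let m , m≤ , p = suffix vs a∈vs last≡ uniq linked in m , ℕₚ.m≤n⇒m≤1+n m≤ , p

    -- Loop erasure: if the new vertex already lies on the path, only the part of the path from
    -- there on is kept.
    walk⇒simple : ∀ {ℓ i j} → Walk R ℓ i j → ∃ λ m → m ≤ ℓ × SimpleWalk R m i j
    walk⇒simple {i = i} [] = 0 , z≤n , i ∷ [] , refl , refl , ([] ∷ []) , [-]
    walk⇒simple {i = i} (r ∷ w) with walk⇒simple w
    ... | m , m≤ , vs@(_ ∷ _) , refl , last≡ , uniq , linked with _∈?_ _≟_ i vs
    ...   | yes i∈vs = let m′ , m′≤ , p = suffix vs i∈vs last≡ uniq linked
                       in m′ , ℕₚ.m≤n⇒m≤1+n (ℕₚ.≤-trans m′≤ m≤) , p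
    ...   | no  i∉vs = suc m , s≤s m≤ , i ∷ vs , refl , last≡ , (∉⇒All≢ vs i∉vs ∷ uniq) , r ∷ linked
      where
      ∉⇒All≢ : ∀ {k} (vs : Vec (Fin n) k) → ¬ (i ∈ vs) → All (i ≢_) vs
      ∉⇒All≢ []       i∉ = []
      ∉⇒All≢ (v ∷ vs) i∉ = (i∉ ∘ here) ∷ ∉⇒All≢ vs (i∉ ∘ there)

  module TreeDistance {n : ℕ} (T : Tree n) where
    open Tree T

    opaque
      D : Fin n → Fin n → ℕ
      D = distance T

      D≡distance : ∀ i j → D i j ≡ distance T i j
      D≡distance i j = refl

      D-walk : ∀ i j → Walk Adj (D i j) i j
      D-walk i j = simple⇒walk (proj₁ (proj₂ (shortestPath T i j)))

      D-minimal : ∀ {ℓ i j} → Walk Adj ℓ i j → D i j ≤ ℓ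
      D-minimal {i = i} {j} w =
        let m , m≤ , p = walk⇒simple w in ℕₚ.≤-trans (proj₂ (proj₂ (shortestPath T i j)) m p) m≤

      D-bounded : ∀ {d} → IsDiameter graph d → ∀ i j → D i j ≤ d
      D-bounded (_ , maximal) i j = maximal i j _ (proj₁ (proj₂ (shortestPath T i j)))

    D-refl : ∀ i → D i i ≡ 0
    D-refl i = ℕₚ.n≤0⇒n≡0 (D-minimal [])

    D-sym : ∀ i j → D i j ≡ D j i
    D-sym i j = ℕₚ.≤-antisym (D-minimal (reverse adj-sym (D-walk j i))) (D-minimal (reverse adj-sym (D-walk i j)))

    D-positive : ∀ {i j} → i ≢ j → 0 < D i j
    D-positive {i} {j} i≢j with D i j | D-walk i j
    ... | zero  | []    = contradiction refl i≢j
    ... | suc _ | _ ∷ _ = s≤s z≤n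

    AdjAvoiding : Fin n → Rel (Fin n) 0ℓ
    AdjAvoiding i a b = Adj a b × a ≢ i × b ≢ i

    avoiding-sym : ∀ i → Symmetric (AdjAvoiding i)
    avoiding-sym i (a~b , a≢i , b≢i) = adj-sym a~b , b≢i , a≢i

    -- A visit to i would leave fewer than `D i j` steps for getting from i to j.
    avoid : ∀ {i j ℓ a} → a ≢ i → ℓ ≤ D i j → Walk Adj ℓ a j → Walk (AdjAvoiding i) ℓ a j
    avoid a≢i ℓ≤ [] = []
    avoid {i} {j} a≢i ℓ≤ (_∷_ {ℓ = ℓ} {j = b} a~b w) = (a~b , a≢i , b≢i) ∷ avoid b≢i (ℕₚ.<⇒≤ ℓ≤) w
      where
      b≢i : b ≢ i
      b≢i refl = ℕₚ.<⇒≱ ℓ≤ (D-minimal w)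

    -- A path from w to u off i closes up through i. It has at least one edge because w ≠ u, so the
    -- cycle has at least three vertices.
    neighbours-separated : ∀ {i u w ℓ} → Adj i u → Adj i w → w ≢ u → ¬ Walk (AdjAvoiding i) ℓ w u
    neighbours-separated {i} i~u i~w w≢u walk with walk⇒simple walk
    ... | zero  , _ , v ∷ []     , refl , last≡ , _    , _      = w≢u last≡
    ... | suc m , _ , vs@(v ∷ v′ ∷ _) , refl , refl , uniq , linked =
      acyclic (m , i ∷ vs , (avoids vs linked ∷ uniq) , (i~w ∷ Linked.map proj₁ linked) , adj-sym i~u)
      where
      avoids : ∀ {m} (vs : Vec (Fin n) (2 + m)) → Linked (AdjAvoiding i) vs → All (i ≢_) vs
      avoids (_ ∷ _ ∷ [])     ((_ , a≢i , b≢i) ∷ _) = (a≢i ∘ sym) ∷ (b≢i ∘ sym) ∷ []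
      avoids (_ ∷ vs@(_ ∷ _ ∷ _)) ((_ , a≢i , _) ∷ rs)  = (a≢i ∘ sym) ∷ avoids vs rs

    record NextVertex (i j : Fin n) : Set where
      field
        next       : Fin n
        adjacent   : Adj i next
        closer     : D i j ≡ suc (D next j)
        others     : ∀ w → Adj i w → w ≢ next → D w j ≡ suc (D i j)

    -- The first step u of a shortest walk is taken. Another neighbour w no farther from j than i
    -- could go to j and on to u without meeting i, against `neighbours-separated`; so w is farther
    -- than i, and as a neighbour by exactly one.
    nextVertex : ∀ {i j} → i ≢ j → NextVertex i j
    nextVertex {i} {j} i≢j = from-walk (D-walk i j) refl
      where
      from-walk : ∀ {ℓ} → Walk Adj ℓ i j → ℓ ≡ D i j → NextVertex i j
      from-walk []                               _  = contradiction refl i≢j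
      from-walk (_∷_ {ℓ = ℓ} {j = u} i~u walk) ℓ≡ = record
        { next = u ; adjacent = i~u ; closer = closer ; others = others }
        where
        closer : D i j ≡ suc (D u j)
        closer = ℕₚ.≤-antisym (D-minimal (i~u ∷ D-walk u j))
          (ℕₚ.≤-trans (s≤s (D-minimal walk)) (ℕₚ.≤-reflexive ℓ≡))
        others : ∀ w → Adj i w → w ≢ u → D w j ≡ suc (D i j)
        others w i~w w≢u with D w j ℕₚ.≤? D i j
        ... | no  Dwj≰ = ℕₚ.≤-antisym (D-minimal (adj-sym i~w ∷ D-walk i j)) (ℕₚ.≰⇒> Dwj≰)
        ... | yes Dwj≤ = contradiction
          (reverse-append (avoiding-sym i)
            (reverse (avoiding-sym i) (avoid (λ { refl → adj-irrefl refl i~w }) Dwj≤ (D-walk w j)))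
            (reverse (avoiding-sym i) (avoid (λ { refl → adj-irrefl refl i~u }) (ℕₚ.<⇒≤ (ℕₚ.≤-reflexive ℓ≡)) walk)))
          (neighbours-separated i~u i~w w≢u)

-- Finite sums of integers

module _ where
  open import Data.Integer.Base hiding (suc; pred; _^_)

  opaque
    ∑ : ∀ {n} → (Fin n → ℤ) → ℤ
    ∑ = sum

    ∑≡sum : ∀ {n} (f : Fin n → ℤ) → ∑ f ≡ sum f
    ∑≡sum f = refl

    ∑-cong : ∀ {n} {f g : Fin n → ℤ} → (∀ i → f i ≡ g i) → ∑ f ≡ ∑ g
    ∑-cong = SemiringSum.sum-cong-≗ ℤₚ.+-*-semiring

    ∑-+ : ∀ {n} (f g : Fin n → ℤ) → ∑ (λ i → f i + g i) ≡ ∑ f + ∑ g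
    ∑-+ = SemiringSum.∑-distrib-+ ℤₚ.+-*-semiring

    ∑-*ˡ : ∀ {n} x (f : Fin n → ℤ) → ∑ (λ i → x * f i) ≡ x * ∑ f
    ∑-*ˡ x f = sym (SemiringSum.*-distribˡ-sum ℤₚ.+-*-semiring x f)

    ∑-comm : ∀ {m n} (f : Fin m → Fin n → ℤ) → ∑ (λ i → ∑ (f i)) ≡ ∑ (λ j → ∑ (λ i → f i j))
    ∑-comm = SemiringSum.∑-comm ℤₚ.+-*-semiring

    ∑-neg : ∀ {n} (f : Fin n → ℤ) → ∑ (λ i → - f i) ≡ - ∑ f
    ∑-neg = Determinant.sum-neg ℤₚ.+-*-commutativeRing

    ∑-single : ∀ {n} (f : Fin n → ℤ) i → (∀ j → j ≢ i → f j ≡ 0ℤ) → ∑ f ≡ f i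
    ∑-single = Determinant.sum-single ℤₚ.+-*-commutativeRing

    ∑-mono : ∀ {n} {f g : Fin n → ℤ} → (∀ i → f i ≤ g i) → ∑ f ≤ ∑ g
    ∑-mono {zero}  f≤g = ℤₚ.≤-refl
    ∑-mono {suc n} f≤g = ℤₚ.+-mono-≤ (f≤g zero) (∑-mono (f≤g ∘ suc))

    ∑-const : ∀ n x → ∑ {n} (λ _ → x) ≡ + n * x
    ∑-const zero    x = refl
    ∑-const (suc n) x = trans (cong (λ y → x + y) (∑-const n x)) (sym (ℤₚ.suc-* (+ n) x))

    ∑-remove : ∀ {n} i (f : Fin (suc n) → ℤ) → ∑ f ≡ f i + ∑ (λ j → f (punchIn i j))
    ∑-remove i f = SemiringSum.sum-remove ℤₚ.+-*-semiring {i = i} f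

  ∑-*ʳ : ∀ {n} x (f : Fin n → ℤ) → ∑ (λ i → f i * x) ≡ ∑ f * x
  ∑-*ʳ x f = trans (∑-cong λ i → ℤₚ.*-comm (f i) x) (trans (∑-*ˡ x f) (ℤₚ.*-comm x (∑ f)))

  ∑-nonneg : ∀ {n} {f : Fin n → ℤ} → (∀ i → 0ℤ ≤ f i) → 0ℤ ≤ ∑ f
  ∑-nonneg {n} {f} 0≤f = subst (_≤ ∑ f) (trans (∑-const n 0ℤ) (ℤₚ.*-zeroʳ (+ n))) (∑-mono 0≤f)

  ∑-term≤ : ∀ {n} {f : Fin n → ℤ} → (∀ i → 0ℤ ≤ f i) → ∀ i → f i ≤ ∑ f
  ∑-term≤ {suc n} {f} 0≤f i = begin
    f i                              ≡⟨ ℤₚ.+-identityʳ (f i) ⟨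
    f i + 0ℤ                         ≤⟨ ℤₚ.+-monoʳ-≤ (f i) (∑-nonneg (λ j → 0≤f (punchIn i j))) ⟩
    f i + ∑ (λ j → f (punchIn i j))  ≡⟨ ∑-remove i f ⟨
    ∑ f                              ∎
    where open ℤₚ.≤-Reasoning

  -- The quadratic form of a tree distance matrix

  infixl 7 _·_
  _·_ : ∀ {n} → (Fin n → ℤ) → (Fin n → ℤ) → ℤ
  x · y = ∑ λ i → x i * y i

  infixr 8 _⊛_
  _⊛_ : ∀ {m n} → (Fin m → Fin n → ℤ) → (Fin n → ℤ) → Fin m → ℤ
  (A ⊛ x) i = A i · x

  -- Tested on integer vectors only: unit vectors, cofactor rows and their integral combinations are
  -- the only vectors that occur later.
  record StrictlyCND {n} (A : Matrix ℤ n) : Set where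
    field
      nonpositive : ∀ x → ∑ x ≡ 0ℤ → x · (A ⊛ x) ≤ 0ℤ
      definite    : ∀ x → ∑ x ≡ 0ℤ → x · (A ⊛ x) ≡ 0ℤ → ∀ i → x i ≡ 0ℤ

  square-nonneg : ∀ x → 0ℤ ≤ x * x
  square-nonneg (+ n)     = ℤₚ.≤-trans (+≤+ ℕ.z≤n) (ℤₚ.≤-reflexive (ℤₚ.pos-* n n))
  square-nonneg -[1+ n ]  = +≤+ ℕ.z≤n

  ⟦_⟧ : {P : Set} → Dec P → ℤ
  ⟦ P? ⟧ = if does P? then 1ℤ else 0ℤ

  ⟦⟧-true : {P : Set} (P? : Dec P) → P → ⟦ P? ⟧ ≡ 1ℤ
  ⟦⟧-true P? p rewrite dec-true P? p = refl

  ⟦⟧-false : {P : Set} (P? : Dec P) → (P → ⊥) → ⟦ P? ⟧ ≡ 0ℤ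
  ⟦⟧-false P? ¬p rewrite dec-false P? ¬p = refl

  module TreeForm {n : ℕ} (T : Tree n) where
    open Tree T
    open TreeDistance T
    open ≡-Reasoning

    α : Matrix ℤ n
    α i u = ⟦ adj? i u ⟧

    α-sym : ∀ i u → α i u ≡ α u i
    α-sym i u with adj? i u
    ... | yes i~u = sym (⟦⟧-true (adj? u i) (adj-sym i~u))
    ... | no  i≁u = sym (⟦⟧-false (adj? u i) (i≁u ∘ adj-sym))

    degree : Fin n → ℤ
    degree i = ∑ (α i)

    Dℤ : Matrix ℤ n
    Dℤ i j = + D i j

    laplacian : (Fin n → ℤ) → Fin n → ℤ
    laplacian y i = ∑ λ u → α i u * (y i - y u)

    private
      descend : ∀ x → (1ℤ + x) - x ≡ 1ℤ
      descend = solve-∀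

      ascend : ∀ x → x - (1ℤ + x) ≡ -1ℤ
      ascend = solve-∀

    laplacian-off : ∀ {i j} → NextVertex i j → laplacian (λ v → Dℤ v j) i ≡ + 2 - degree i
    laplacian-off {i} {j} nextVertex = begin
      ∑ (λ u → α i u * (Dℤ i j - Dℤ u j))       ≡⟨ ∑-cong term ⟩
      ∑ (λ u → + 2 * ⟦ u ≟ next ⟧ + - α i u)    ≡⟨ ∑-+ (λ u → + 2 * ⟦ u ≟ next ⟧) (λ u → - α i u) ⟩
      ∑ (λ u → + 2 * ⟦ u ≟ next ⟧) + ∑ (λ u → - α i u)
        ≡⟨ cong₂ _+_ (trans (∑-single _ next λ u u≢ → cong (+ 2 *_) (⟦⟧-false (u ≟ next) u≢))
                            (cong (+ 2 *_) (⟦⟧-true (next ≟ next) refl)))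
                     (∑-neg (α i)) ⟩
      + 2 - degree i                            ∎
      where
      open NextVertex nextVertex
      -- A neighbour contributes 1 if it is `next` and -1 otherwise, which is 2 [u = next] - 1; any
      -- other vertex contributes 0.
      term : ∀ u → α i u * (Dℤ i j - Dℤ u j) ≡ + 2 * ⟦ u ≟ next ⟧ + - α i u
      term u with u ≟ next
      ... | yes refl = cong₂ (λ a x → a * (x - Dℤ u j)) α≡1 (cong +_ closer) ⟨ trans ⟩ cong (1ℤ *_) (descend (Dℤ u j))
        ⟨ trans ⟩ cong (λ a → + 2 + - a) (sym α≡1)
        where
        α≡1 : α i u ≡ 1ℤ
        α≡1 = ⟦⟧-true (adj? i u) adjacent
      ... | no  u≢next with adj? i u
      ...   | yes i~u = cong (λ x → 1ℤ * (Dℤ i j - + x)) (others u i~u u≢next) ⟨ trans ⟩ cong (1ℤ *_) (ascend (Dℤ i j))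
      ...   | no  _   = refl

    laplacian-diagonal : ∀ i → laplacian (λ v → Dℤ v i) i ≡ - degree i
    laplacian-diagonal i = trans (∑-cong term) (∑-neg (α i))
      where
      term : ∀ u → α i u * (Dℤ i i - Dℤ u i) ≡ - α i u
      term u with adj? i u
      ... | no  _   = refl
      ... | yes i~u = cong₂ (λ x y → 1ℤ * (+ x - + y)) (D-refl i)
        (ℕₚ.≤-antisym (D-minimal (adj-sym i~u ∷ [])) (D-positive λ { refl → adj-irrefl refl i~u }))

    laplacian-distance : ∀ i j → laplacian (λ v → Dℤ v j) i ≡ + 2 - degree i - + 2 * ⟦ i ≟ j ⟧
    laplacian-distance i j with i ≟ j
    ... | yes refl = trans (laplacian-diagonal i) (solution (degree i))
      where
      solution : ∀ x → - x ≡ + 2 - x - + 2 * 1ℤ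
      solution = solve-∀
    ... | no  i≢j  = trans (laplacian-off (nextVertex i≢j)) (sym (ℤₚ.+-identityʳ _))

    energy : (Fin n → ℤ) → ℤ
    energy y = ∑ λ i → ∑ λ u → α i u * ((y i - y u) * (y i - y u))

    -- Green's identity: the square splits as x (x - y) + y (y - x), and exchanging the ends of the
    -- edge in the second half makes both halves equal.
    energy-laplacian : ∀ y → energy y ≡ + 2 * (y · laplacian y)
    energy-laplacian y = begin
      ∑ (λ i → ∑ λ u → α i u * ((y i - y u) * (y i - y u)))
        ≡⟨ ∑-cong (λ i → trans (∑-cong λ u → split (α i u) (y i) (y u)) (∑-+ (λ u → outer i u) (λ u → inner i u))) ⟩
      ∑ (λ i → ∑ (outer i) + ∑ (inner i))
        ≡⟨ ∑-+ (λ i → ∑ (outer i)) (λ i → ∑ (inner i)) ⟩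
      ∑ (λ i → ∑ (outer i)) + ∑ (λ i → ∑ (inner i))
        ≡⟨ cong (λ s → ∑ (λ i → ∑ (outer i)) + s) (trans (∑-comm inner) (∑-cong λ u → ∑-cong λ i → cong (λ a → y u * (a * (y u - y i))) (α-sym i u))) ⟩
      ∑ (λ i → ∑ (outer i)) + ∑ (λ i → ∑ (outer i))
        ≡⟨ cong (λ x → x + x) (∑-cong λ i → ∑-*ˡ (y i) (λ u → α i u * (y i - y u))) ⟩
      y · laplacian y + y · laplacian y
        ≡⟨ double (y · laplacian y) ⟩
      + 2 * (y · laplacian y)  ∎
      where
      outer inner : Matrix ℤ n
      outer i u = y i * (α i u * (y i - y u))
      inner i u = y u * (α i u * (y u - y i))
      split : ∀ a x y → a * ((x - y) * (x - y)) ≡ x * (a * (x - y)) + y * (a * (y - x))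
      split = solve-∀
      double : ∀ x → x + x ≡ + 2 * x
      double = solve-∀

    module _ {m : ℕ} (σ : Fin m → Fin n) (x : Fin m → ℤ) where

      potential : Fin n → ℤ
      potential = (λ i k → Dℤ i (σ k)) ⊛ x

      -- Push-forward of `x` along `σ`, zero off the image. The Laplacian lives on the whole tree
      -- while `x` is indexed by a principal submatrix; `potential` is D times this vector.
      mass : Fin n → ℤ
      mass i = ∑ λ k → ⟦ i ≟ σ k ⟧ * x k

      -- The part `2 - degree i` of `laplacian-distance` does not depend on k and is killed by Σ x =
      -- 0; only the term with [i = σ k] survives.
      laplacian-potential : ∑ x ≡ 0ℤ → ∀ i → laplacian potential i ≡ - (+ 2 * mass i)
      laplacian-potential ∑x≡0 i = begin
        ∑ (λ u → α i u * (potential i - potential u))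
          ≡⟨ ∑-cong term ⟩
        ∑ (λ u → ∑ λ k → α i u * (Dℤ i (σ k) - Dℤ u (σ k)) * x k)
          ≡⟨ ∑-comm (λ u k → α i u * (Dℤ i (σ k) - Dℤ u (σ k)) * x k) ⟩
        ∑ (λ k → ∑ λ u → α i u * (Dℤ i (σ k) - Dℤ u (σ k)) * x k)
          ≡⟨ ∑-cong (λ k → trans (∑-*ʳ (x k) (λ u → α i u * (Dℤ i (σ k) - Dℤ u (σ k)))) (cong (_* x k) (laplacian-distance i (σ k)))) ⟩
        ∑ (λ k → (+ 2 - degree i - + 2 * ⟦ i ≟ σ k ⟧) * x k)
          ≡⟨ ∑-cong (λ k → separate (degree i) ⟦ i ≟ σ k ⟧ (x k)) ⟩
        ∑ (λ k → (+ 2 - degree i) * x k + -[1+ 1 ] * (⟦ i ≟ σ k ⟧ * x k))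
          ≡⟨ ∑-+ (λ k → (+ 2 - degree i) * x k) (λ k → -[1+ 1 ] * (⟦ i ≟ σ k ⟧ * x k)) ⟩
        ∑ (λ k → (+ 2 - degree i) * x k) + ∑ (λ k → -[1+ 1 ] * (⟦ i ≟ σ k ⟧ * x k))
          ≡⟨ cong₂ _+_ (trans (∑-*ˡ (+ 2 - degree i) x) (cong ((+ 2 - degree i) *_) ∑x≡0)) (∑-*ˡ -[1+ 1 ] (λ k → ⟦ i ≟ σ k ⟧ * x k)) ⟩
        (+ 2 - degree i) * 0ℤ + -[1+ 1 ] * mass i
          ≡⟨ collect (+ 2 - degree i) (mass i) ⟩
        - (+ 2 * mass i)  ∎
        where
        separate : ∀ d e x → (+ 2 - d - + 2 * e) * x ≡ (+ 2 - d) * x + -[1+ 1 ] * (e * x)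
        separate = solve-∀
        collect : ∀ c y → c * 0ℤ + -[1+ 1 ] * y ≡ - (+ 2 * y)
        collect = solve-∀
        difference : ∀ a p q x → a * (p - q) * x ≡ a * (p * x) + - a * (q * x)
        difference = solve-∀
        factor : ∀ a p q → a * p + - a * q ≡ a * (p - q)
        factor = solve-∀
        term : ∀ u → α i u * (potential i - potential u) ≡ ∑ λ k → α i u * (Dℤ i (σ k) - Dℤ u (σ k)) * x k
        term u = sym (begin
          ∑ (λ k → α i u * (Dℤ i (σ k) - Dℤ u (σ k)) * x k)
            ≡⟨ ∑-cong (λ k → difference (α i u) (Dℤ i (σ k)) (Dℤ u (σ k)) (x k)) ⟩
          ∑ (λ k → α i u * (Dℤ i (σ k) * x k) + - α i u * (Dℤ u (σ k) * x k))
            ≡⟨ ∑-+ (λ k → α i u * (Dℤ i (σ k) * x k)) (λ k → - α i u * (Dℤ u (σ k) * x k)) ⟩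
          ∑ (λ k → α i u * (Dℤ i (σ k) * x k)) + ∑ (λ k → - α i u * (Dℤ u (σ k) * x k))
            ≡⟨ cong₂ _+_ (∑-*ˡ (α i u) (λ k → Dℤ i (σ k) * x k)) (∑-*ˡ (- α i u) (λ k → Dℤ u (σ k) * x k)) ⟩
          α i u * potential i + - α i u * potential u
            ≡⟨ factor (α i u) (potential i) (potential u) ⟩
          α i u * (potential i - potential u)  ∎)

      potential·mass : potential · mass ≡ x · (potential ∘ σ)
      potential·mass = begin
        ∑ (λ i → potential i * mass i)
          ≡⟨ ∑-cong (λ i → sym (∑-*ˡ (potential i) (λ k → ⟦ i ≟ σ k ⟧ * x k))) ⟩
        ∑ (λ i → ∑ λ k → potential i * (⟦ i ≟ σ k ⟧ * x k))
          ≡⟨ ∑-comm (λ i k → potential i * (⟦ i ≟ σ k ⟧ * x k)) ⟩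
        ∑ (λ k → ∑ λ i → potential i * (⟦ i ≟ σ k ⟧ * x k))
          ≡⟨ ∑-cong (λ k → trans (∑-single (λ i → potential i * (⟦ i ≟ σ k ⟧ * x k)) (σ k)
                (λ i i≢ → trans (cong (λ e → potential i * (e * x k)) (⟦⟧-false (i ≟ σ k) i≢)) (ℤₚ.*-zeroʳ (potential i))))
                (trans (cong (λ e → potential (σ k) * (e * x k)) (⟦⟧-true (σ k ≟ σ k) refl)) (swap (potential (σ k)) (x k)))) ⟩
        ∑ (λ k → x k * potential (σ k))  ∎
        where
        swap : ∀ p x → p * (1ℤ * x) ≡ x * p
        swap = solve-∀

      energy-potential : ∑ x ≡ 0ℤ → energy potential ≡ - (+ 4 * (x · (potential ∘ σ)))
      energy-potential ∑x≡0 = begin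
        energy potential                                   ≡⟨ energy-laplacian potential ⟩
        + 2 * (potential · laplacian potential)            ≡⟨ cong (+ 2 *_) (∑-cong λ i → trans (cong (potential i *_) (laplacian-potential ∑x≡0 i)) (pull (potential i) (mass i))) ⟩
        + 2 * ∑ (λ i → -[1+ 1 ] * (potential i * mass i))  ≡⟨ cong (+ 2 *_) (∑-*ˡ -[1+ 1 ] (λ i → potential i * mass i)) ⟩
        + 2 * (-[1+ 1 ] * (potential · mass))              ≡⟨ cong (λ q → + 2 * (-[1+ 1 ] * q)) potential·mass ⟩
        + 2 * (-[1+ 1 ] * (x · (potential ∘ σ)))           ≡⟨ collect (x · (potential ∘ σ)) ⟩
        - (+ 4 * (x · (potential ∘ σ)))                    ∎
        where
        pull : ∀ p q → p * - (+ 2 * q) ≡ -[1+ 1 ] * (p * q)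
        pull = solve-∀
        collect : ∀ q → + 2 * (-[1+ 1 ] * q) ≡ - (+ 4 * q)
        collect = solve-∀

    edgeEnergy-nonneg : ∀ (y : Fin n → ℤ) i u → 0ℤ ≤ α i u * ((y i - y u) * (y i - y u))
    edgeEnergy-nonneg y i u with adj? i u
    ... | yes _ = subst (0ℤ ≤_) (sym (ℤₚ.*-identityˡ _)) (square-nonneg (y i - y u))
    ... | no  _ = ℤₚ.≤-refl

    energy-nonneg : ∀ y → 0ℤ ≤ energy y
    energy-nonneg y = ∑-nonneg λ i → ∑-nonneg λ u → edgeEnergy-nonneg y i u

    -- A vanishing sum of nonnegative edge terms forces `y` to agree at the two ends of every edge.
    energy≡0⇒harmonic : ∀ y → energy y ≡ 0ℤ → ∀ i → laplacian y i ≡ 0ℤ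
    energy≡0⇒harmonic y energy≡0 i = trans (∑-cong λ u → term u) (trans (∑-const n 0ℤ) (ℤₚ.*-zeroʳ (+ n)))
      where
      edge≡0 : ∀ u → α i u * ((y i - y u) * (y i - y u)) ≡ 0ℤ
      edge≡0 u = ℤₚ.≤-antisym
        (ℤₚ.≤-trans (∑-term≤ {f = λ u → α i u * ((y i - y u) * (y i - y u))} (edgeEnergy-nonneg y i) u)
          (ℤₚ.≤-trans (∑-term≤ {f = λ i → ∑ λ u → α i u * ((y i - y u) * (y i - y u))} (λ j → ∑-nonneg (edgeEnergy-nonneg y j)) i) (ℤₚ.≤-reflexive energy≡0)))
        (edgeEnergy-nonneg y i u)
      term : ∀ u → α i u * (y i - y u) ≡ 0ℤ
      term u with ℤₚ.i*j≡0⇒i≡0∨j≡0 (α i u) (edge≡0 u)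
      ... | inj₁ α≡0 = cong (_* (y i - y u)) α≡0
      ... | inj₂ square≡0 = trans (cong (α i u *_) ([ id , id ]′ (ℤₚ.i*j≡0⇒i≡0∨j≡0 (y i - y u) square≡0))) (ℤₚ.*-zeroʳ (α i u))

    submatrix : ∀ {m} → (Fin m → Fin n) → Matrix ℤ m
    submatrix σ k l = Dℤ (σ k) (σ l)

    -- Minus four times the form is an energy, hence nonnegative. If it is zero, then so is the
    -- Laplacian of the potential, which is -2 `mass`; by injectivity of `σ`, the mass at `σ k` is
    -- `x k`.
    submatrix-cnd : ∀ {m} (σ : Fin m → Fin n) → (∀ {k l} → σ k ≡ σ l → k ≡ l) → StrictlyCND (submatrix σ)
    submatrix-cnd σ σ-injective = record
      { nonpositive = λ x ∑x≡0 → ℤₚ.≮⇒≥ λ 0<q → ℤₚ.<⇒≱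
          (ℤₚ.neg-mono-< (ℤₚ.*-monoˡ-<-pos (+ 4) 0<q))
          (subst (0ℤ ≤_) (energy-potential σ x ∑x≡0) (energy-nonneg (potential σ x)))
      ; definite = λ x ∑x≡0 q≡0 k → trans (sym (mass-σ x k)) (massless x ∑x≡0 q≡0 (σ k))
      }
      where
      mass-σ : ∀ x k → mass σ x (σ k) ≡ x k
      mass-σ x k = trans
        (∑-single _ k λ l l≢k → cong (_* x l) (⟦⟧-false (σ k ≟ σ l) (l≢k ∘ sym ∘ σ-injective)))
        (trans (cong (_* x k) (⟦⟧-true (σ k ≟ σ k) refl)) (ℤₚ.*-identityˡ (x k)))
      massless : ∀ x ∑x≡0 → x · (submatrix σ ⊛ x) ≡ 0ℤ → ∀ i → mass σ x i ≡ 0ℤ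
      massless x ∑x≡0 q≡0 i = ℤₚ.*-cancelˡ-≡ (+ 2) _ _ (ℤₚ.neg-injective (trans (sym (laplacian-potential σ x ∑x≡0 i))
        (energy≡0⇒harmonic (potential σ x) (trans (energy-potential σ x ∑x≡0) (cong (λ q → - (+ 4 * q)) q≡0)) i)))

  -- Principal minors

  open ℤ-Det using (Det; alt; cofactor)

  ·-single : ∀ {n} (x y : Fin n → ℤ) i → (∀ j → j ≢ i → y j ≡ 0ℤ) → x · y ≡ x i * y i
  ·-single x y i y≡0 = ∑-single (λ j → x j * y j) i λ j j≢i → trans (cong (x j *_) (y≡0 j j≢i)) (ℤₚ.*-zeroʳ (x j))

  ·-linearʳ : ∀ {n} (a b : ℤ) (x y z : Fin n → ℤ) → x · (λ i → a * y i - b * z i) ≡ a * (x · y) - b * (x · z)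
  ·-linearʳ a b x y z = begin
    ∑ (λ i → x i * (a * y i - b * z i))                      ≡⟨ ∑-cong (λ i → distribute a b (x i) (y i) (z i)) ⟩
    ∑ (λ i → a * (x i * y i) + - b * (x i * z i))            ≡⟨ ∑-+ (λ i → a * (x i * y i)) (λ i → - b * (x i * z i)) ⟩
    ∑ (λ i → a * (x i * y i)) + ∑ (λ i → - b * (x i * z i))  ≡⟨ cong₂ _+_ (∑-*ˡ a (λ i → x i * y i)) (∑-*ˡ (- b) (λ i → x i * z i)) ⟩
    a * (x · y) + - b * (x · z)                              ≡⟨ cong (λ t → a * (x · y) + t) (ℤₚ.neg-distribˡ-* b (x · z)) ⟨
    a * (x · y) - b * (x · z)                                ∎
    where
    open ≡-Reasoning
    distribute : ∀ a b x y z → x * (a * y - b * z) ≡ a * (x * y) + - b * (x * z)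
    distribute = solve-∀

  ·-comm : ∀ {n} (x y : Fin n → ℤ) → x · y ≡ y · x
  ·-comm x y = ∑-cong λ i → ℤₚ.*-comm (x i) (y i)

  ·-linearˡ : ∀ {n} (a b : ℤ) (x y z : Fin n → ℤ) → (λ i → a * y i - b * z i) · x ≡ a * (y · x) - b * (z · x)
  ·-linearˡ a b x y z = trans (·-comm _ x) (trans (·-linearʳ a b x y z)
    (cong₂ (λ s t → a * s - b * t) (·-comm x y) (·-comm x z)))

  ⊛-self-adjoint : ∀ {n} (A : Matrix ℤ n) → (∀ i j → A i j ≡ A j i) → ∀ x y → x · (A ⊛ y) ≡ y · (A ⊛ x)
  ⊛-self-adjoint A A-sym x y = begin
    ∑ (λ i → x i * ∑ (λ j → A i j * y j))    ≡⟨ ∑-cong (λ i → sym (∑-*ˡ (x i) (λ j → A i j * y j))) ⟩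
    ∑ (λ i → ∑ λ j → x i * (A i j * y j))    ≡⟨ ∑-comm (λ i j → x i * (A i j * y j)) ⟩
    ∑ (λ j → ∑ λ i → x i * (A i j * y j))
      ≡⟨ ∑-cong (λ j → ∑-cong λ i → trans (cong (λ a → x i * (a * y j)) (A-sym i j)) (rotate (x i) (A j i) (y j))) ⟩
    ∑ (λ j → ∑ λ i → y j * (A j i * x i))    ≡⟨ ∑-cong (λ j → ∑-*ˡ (y j) (λ i → A j i * x i)) ⟩
    ∑ (λ j → y j * ∑ (λ i → A j i * x i))    ∎
    where
    open ≡-Reasoning
    rotate : ∀ x a y → x * (a * y) ≡ y * (a * x)
    rotate = solve-∀

  unit : ∀ {n} → Fin n → Fin n → ℤ
  unit i j = ⟦ j ≟ i ⟧

  unit-off : ∀ {n} (i : Fin n) j → j ≢ i → unit i j ≡ 0ℤ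
  unit-off i j j≢i = ⟦⟧-false (j ≟ i) j≢i

  ·-unit : ∀ {n} (x : Fin n → ℤ) i → x · unit i ≡ x i
  ·-unit x i = trans (·-single x (unit i) i (unit-off i))
    (trans (cong (x i *_) (⟦⟧-true (i ≟ i) refl)) (ℤₚ.*-identityʳ (x i)))

  ones : ∀ {n} → Fin n → ℤ
  ones _ = 1ℤ

  ·-ones : ∀ {n} (x : Fin n → ℤ) → x · ones ≡ ∑ x
  ·-ones x = ∑-cong λ i → ℤₚ.*-identityʳ (x i)

  -- All that the sign argument uses of a distance matrix.
  record Hollow {n} (A : Matrix ℤ n) : Set where
    field
      symmetric    : ∀ i j → A i j ≡ A j i
      diagonal     : ∀ i → A i i ≡ 0ℤ
      strictlyCND  : StrictlyCND A
    open StrictlyCND strictlyCND public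

  module HollowMatrix {n} {A : Matrix ℤ n} (hollow : Hollow A) where
    open Hollow hollow

    module _ (y : Fin n → ℤ) (i : Fin n) (Ay≡0 : (A ⊛ y) i ≡ 0ℤ) where

      private
        open ≡-Reasoning

        balanced : Fin n → ℤ
        balanced j = 1ℤ * y j - ∑ y * unit i j

        ∑-balanced : ∑ balanced ≡ 0ℤ
        ∑-balanced = begin
          ∑ balanced                                      ≡⟨ ·-ones balanced ⟨
          balanced · ones                                 ≡⟨ ·-linearˡ 1ℤ (∑ y) ones y (unit i) ⟩
          1ℤ * (y · ones) - ∑ y * (unit i · ones)         ≡⟨ cong₂ (λ s t → 1ℤ * s - ∑ y * t) (·-ones y) (trans (·-comm (unit i) ones) (·-unit ones i)) ⟩
          1ℤ * ∑ y - ∑ y * 1ℤ                             ≡⟨ cancel (∑ y) ⟩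
          0ℤ                                              ∎
          where
          cancel : ∀ s → 1ℤ * s - s * 1ℤ ≡ 0ℤ
          cancel = solve-∀

        A-unit : ∀ k → (A ⊛ unit i) k ≡ A k i
        A-unit k = ·-unit (A k) i

        A-balanced : ∀ k → (A ⊛ balanced) k ≡ 1ℤ * (A ⊛ y) k - ∑ y * (A ⊛ unit i) k
        A-balanced k = ·-linearʳ 1ℤ (∑ y) (A k) y (unit i)

        form-balanced : balanced · (A ⊛ balanced) ≡ y · (A ⊛ y)
        form-balanced = begin
          balanced · (A ⊛ balanced)
            ≡⟨ ·-linearˡ 1ℤ (∑ y) (A ⊛ balanced) y (unit i) ⟩
          1ℤ * (y · (A ⊛ balanced)) - ∑ y * (unit i · (A ⊛ balanced))
            ≡⟨ cong₂ (λ s t → 1ℤ * s - ∑ y * t) y-part unit-part ⟩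
          1ℤ * (1ℤ * (y · (A ⊛ y)) - ∑ y * 0ℤ) - ∑ y * 0ℤ
            ≡⟨ collect (y · (A ⊛ y)) (∑ y) ⟩
          y · (A ⊛ y)  ∎
          where
          collect : ∀ q s → 1ℤ * (1ℤ * q - s * 0ℤ) - s * 0ℤ ≡ q
          collect = solve-∀
          vanish : ∀ s → 1ℤ * 0ℤ - s * 0ℤ ≡ 0ℤ
          vanish = solve-∀
          unit-part : unit i · (A ⊛ balanced) ≡ 0ℤ
          unit-part = begin
            unit i · (A ⊛ balanced)                    ≡⟨ trans (·-comm (unit i) _) (·-unit (A ⊛ balanced) i) ⟩
            (A ⊛ balanced) i                           ≡⟨ A-balanced i ⟩
            1ℤ * (A ⊛ y) i - ∑ y * (A ⊛ unit i) i      ≡⟨ cong₂ (λ s t → 1ℤ * s - ∑ y * t) Ay≡0 (trans (A-unit i) (diagonal i)) ⟩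
            1ℤ * 0ℤ - ∑ y * 0ℤ                         ≡⟨ vanish (∑ y) ⟩
            0ℤ                                         ∎
          y-part : y · (A ⊛ balanced) ≡ 1ℤ * (y · (A ⊛ y)) - ∑ y * 0ℤ
          y-part = begin
            y · (A ⊛ balanced)                                       ≡⟨ ∑-cong (λ k → cong (y k *_) (A-balanced k)) ⟩
            y · (λ k → 1ℤ * (A ⊛ y) k - ∑ y * (A ⊛ unit i) k)        ≡⟨ ·-linearʳ 1ℤ (∑ y) y (A ⊛ y) (A ⊛ unit i) ⟩
            1ℤ * (y · (A ⊛ y)) - ∑ y * (y · (A ⊛ unit i))
              ≡⟨ cong (λ t → 1ℤ * (y · (A ⊛ y)) - ∑ y * t) (⊛-self-adjoint A symmetric y (unit i) ⟨ trans ⟩ ·-comm (unit i) _ ⟨ trans ⟩ ·-unit (A ⊛ y) i ⟨ trans ⟩ Ay≡0) ⟩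
            1ℤ * (y · (A ⊛ y)) - ∑ y * 0ℤ                            ∎

      -- Subtracting a multiple of the isotropic vector e_i, which is orthogonal
      -- to y, makes the coordinate sum zero and does not change the form.
      orthogonal⇒nonpositive : y · (A ⊛ y) ≤ 0ℤ
      orthogonal⇒nonpositive = subst (_≤ 0ℤ) form-balanced (nonpositive balanced ∑-balanced)

      -- In the equality case definiteness makes `balanced` vanish, so `y` equals `∑ y` times eᵢ.
      orthogonal⇒multiple : y · (A ⊛ y) ≡ 0ℤ → ∀ j → j ≢ i → y j ≡ 0ℤ
      orthogonal⇒multiple q≡0 j j≢i = begin
        y j                          ≡⟨ collect (y j) (∑ y) ⟩
        1ℤ * y j - ∑ y * 0ℤ          ≡⟨ cong (λ t → 1ℤ * y j - ∑ y * t) (unit-off i j j≢i) ⟨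
        balanced j                   ≡⟨ definite balanced ∑-balanced (trans form-balanced q≡0) j ⟩
        0ℤ                           ∎
        where
        collect : ∀ x s → x ≡ 1ℤ * x - s * 0ℤ
        collect = solve-∀

  x≡-x⇒x≡0 : ∀ {x} → x ≡ - x → x ≡ 0ℤ
  x≡-x⇒x≡0 {+0} _ = refl

  -- Row k takes the place of row i and so occurs twice; `punchOut` locates the original among the
  -- rows other than i.
  cofactor-orthogonal : ∀ {n} (A : Matrix ℤ (suc n)) i k → k ≢ i → A k · cofactor A i ≡ 0ℤ
  cofactor-orthogonal {zero}  A zero zero k≢i = contradiction refl k≢i
  cofactor-orthogonal {suc n} A i k k≢i = begin
    A k · cofactor A i                     ≡⟨ ∑≡sum (λ j → A k j * cofactor A i j) ⟩
    _                                      ≡⟨ ℤ-Det.cofactor-expand A i (A k) ⟩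
    alt i (Det (A k V.∷ A ∘ punchIn i))
      ≡⟨ cong (alt i) (x≡-x⇒x≡0 (ℤ-Det.det-repeated (A k) (A ∘ punchIn i) (punchOut (k≢i ∘ sym))
           (λ j → cong (λ l → A l j) (punchIn-punchOut (k≢i ∘ sym))))) ⟩
    alt i 0ℤ                               ≡⟨ ℤ-Det.alt-0 i ⟩
    0ℤ                                     ∎
    where open ≡-Reasoning

  -- (-1)ⁿ⁺¹, which turns out to be the sign of the n × n principal minors for n ≥ 2.
  ε : ℕ → ℤ
  ε zero    = -1ℤ
  ε (suc n) = - ε n

  ε-square : ∀ n → ε n * ε n ≡ 1ℤ
  ε-square zero    = refl
  ε-square (suc n) = trans (square-neg (ε n)) (ε-square n)
    where
    square-neg : ∀ x → - x * - x ≡ x * x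
    square-neg = solve-∀

  signedDet : ∀ {n} → Matrix ℤ n → ℤ
  signedDet {n} A = ε n * Det A

  *-cancel-nonneg : ∀ {p x} → 0ℤ < p → 0ℤ ≤ p * x → 0ℤ ≤ x
  *-cancel-nonneg {p} {x} 0<p 0≤px = ℤₚ.*-cancelˡ-≤-pos 0ℤ x p {{positive 0<p}} (subst (_≤ p * x) (sym (ℤₚ.*-zeroʳ p)) 0≤px)

  *-nonneg : ∀ {x y} → 0ℤ ≤ x → 0ℤ ≤ y → 0ℤ ≤ x * y
  *-nonneg {x} {y} 0≤x 0≤y = subst (_≤ x * y) (ℤₚ.*-zeroʳ x) (ℤₚ.*-monoˡ-≤-nonNeg x {{nonNegative 0≤x}} 0≤y)

  *-positive : ∀ {x y} → 0ℤ < x → 0ℤ < y → 0ℤ < x * y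
  *-positive {x} {y} 0<x 0<y = subst (_< x * y) (ℤₚ.*-zeroʳ x) (ℤₚ.*-monoˡ-<-pos x {{positive 0<x}} 0<y)

  nonneg-difference : ∀ {x y} → 0ℤ ≤ y - x → x ≤ y
  nonneg-difference = ℤₚ.0≤i-j⇒j≤i

  module Minors {n} {A : Matrix ℤ (suc (suc n))} (hollow : Hollow A) where
    open Hollow hollow
    open HollowMatrix hollow
    open ≡-Reasoning

    Δ : ℤ
    Δ = Det A

    minor : Fin (suc (suc n)) → ℤ
    minor i = Det (principal A i)

    private
      -- An index at which A gᵢ vanishes, since A gᵢ = Δ eᵢ; it exists because the size is at least
      -- two.
      other : Fin (suc (suc n)) → Fin (suc (suc n))
      other i = punchIn i zero

      g : Matrix ℤ (suc (suc n))
      g = cofactor A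

      A-g-diagonal : ∀ i → (A ⊛ g i) i ≡ Δ
      A-g-diagonal i = trans (∑≡sum (λ j → A i j * cofactor A i j)) (ℤ-Det.cofactor-row A i)

      A-g-off : ∀ i k → k ≢ i → (A ⊛ g i) k ≡ 0ℤ
      A-g-off = cofactor-orthogonal A

      form-A-g : ∀ i x → x · (A ⊛ g i) ≡ x i * Δ
      form-A-g i x = trans (·-single x (A ⊛ g i) i (A-g-off i)) (cong (x i *_) (A-g-diagonal i))

      g-diagonal : ∀ i → g i i ≡ minor i
      g-diagonal = ℤ-Det.cofactor-diagonal A

      form-g : ∀ i → g i · (A ⊛ g i) ≡ minor i * Δ
      form-g i = trans (form-A-g i (g i)) (cong (_* Δ) (g-diagonal i))

    -- From A gᵢ = Δ eᵢ the form at gᵢ is the diagonal cofactor times Δ, and coordinate `other i`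
    -- supplies the zero that makes the form nonpositive.
    minor*det≤0 : ∀ i → minor i * Δ ≤ 0ℤ
    minor*det≤0 i = subst (_≤ 0ℤ) (form-g i)
      (orthogonal⇒nonpositive (g i) (other i) (A-g-off i (other i) (punchInᵢ≢i i zero)))

    -- If Δ = 0, the form vanishes at gᵢ, so gᵢ is a multiple of the unit vector at `other i`; its
    -- i-th coordinate, the minor, is then 0.
    det≢0 : ∀ i → minor i ≢ 0ℤ → Δ ≢ 0ℤ
    det≢0 i minor≢0 Δ≡0 = minor≢0 (trans (sym (g-diagonal i))
      (orthogonal⇒multiple (g i) (other i) (A-g-off i (other i) (punchInᵢ≢i i zero))
        (trans (form-g i) (trans (cong (minor i *_) Δ≡0) (ℤₚ.*-zeroʳ (minor i)))) i (punchInᵢ≢i i zero ∘ sym)))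

    signedMinor : Fin (suc (suc n)) → ℤ
    signedMinor i = signedDet (principal A i)

    private
      signed-product : ∀ i → signedMinor i * signedDet A ≡ - (minor i * Δ)
      signed-product i = begin
        ε (suc n) * minor i * (- ε (suc n) * Δ)    ≡⟨ regroup (ε (suc n)) (minor i) Δ ⟩
        - (ε (suc n) * ε (suc n) * (minor i * Δ))  ≡⟨ cong (λ s → - (s * (minor i * Δ))) (ε-square (suc n)) ⟩
        - (1ℤ * (minor i * Δ))                     ≡⟨ cong -_ (ℤₚ.*-identityˡ (minor i * Δ)) ⟩
        - (minor i * Δ)                            ∎
        where
        regroup : ∀ e x y → e * x * (- e * y) ≡ - (e * e * (x * y))
        regroup = solve-∀

      signed-square : signedDet A * signedDet A ≡ Δ * Δ
      signed-square = trans (regroup (- ε (suc n)) Δ)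
        (trans (cong (_* (Δ * Δ)) (ε-square (suc (suc n)))) (ℤₚ.*-identityˡ (Δ * Δ)))
        where
        regroup : ∀ e x → e * x * (e * x) ≡ e * e * (x * x)
        regroup = solve-∀

    -- One step in size flips ε and, by `minor*det≤0`, also the sign of the determinant; `det≢0`
    -- makes the inequality strict.
    signedDet-positive : ∀ i → 0ℤ < signedMinor i → 0ℤ < signedDet A
    signedDet-positive i 0<G = ℤₚ.≤∧≢⇒<
      (*-cancel-nonneg 0<G (subst (0ℤ ≤_) (sym (signed-product i)) (ℤₚ.neg-mono-≤ (minor*det≤0 i))))
      (λ 0≡D → det≢0 i minor≢0 (square≡0 (trans (sym signed-square) (cong (λ x → x * x) (sym 0≡D)))))
      where
      minor≢0 : minor i ≢ 0ℤ
      minor≢0 minor≡0 = ℤₚ.<-irrefl (sym (trans (cong (ε (suc n) *_) minor≡0) (ℤₚ.*-zeroʳ (ε (suc n))))) 0<G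
      square≡0 : Δ * Δ ≡ 0ℤ → Δ ≡ 0ℤ
      square≡0 eq with ℤₚ.i*j≡0⇒i≡0∨j≡0 Δ eq
      ... | inj₁ Δ≡0 = Δ≡0
      ... | inj₂ Δ≡0 = Δ≡0

    rowSum : Fin (suc (suc n)) → ℤ
    rowSum i = ∑ (A i)

    total : ℤ
    total = ∑ rowSum

    private
      A-ones : ∀ k → (A ⊛ ones) k ≡ rowSum k
      A-ones k = ·-ones (A k)

      module _ (i : Fin (suc (suc n))) where
        r = rowSum i

        -- The combination of 1 and the i-th cofactor row that is orthogonal to e_i.
        y : Fin (suc (suc n)) → ℤ
        y k = Δ * ones k - r * g i k

        A-y : ∀ k → (A ⊛ y) k ≡ Δ * (A ⊛ ones) k - r * (A ⊛ g i) k
        A-y k = ·-linearʳ Δ r (A k) ones (g i)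

        A-y-i : (A ⊛ y) i ≡ 0ℤ
        A-y-i = trans (A-y i) (trans (cong₂ (λ s t → Δ * s - r * t) (A-ones i) (A-g-diagonal i)) (cancel Δ r))
          where
          cancel : ∀ x r → x * r - r * x ≡ 0ℤ
          cancel = solve-∀

        form-y : y · (A ⊛ y) ≡ Δ * Δ * (total - + 2 * r) + r * r * (minor i * Δ)
        form-y = begin
          y · (A ⊛ y)                                              ≡⟨ ∑-cong (λ k → cong (y k *_) (A-y k)) ⟩
          y · (λ k → Δ * (A ⊛ ones) k - r * (A ⊛ g i) k)           ≡⟨ ·-linearʳ Δ r y (A ⊛ ones) (A ⊛ g i) ⟩
          Δ * (y · (A ⊛ ones)) - r * (y · (A ⊛ g i))               ≡⟨ cong₂ (λ s t → Δ * s - r * t) y-ones (form-A-g i y) ⟩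
          Δ * (Δ * total - r * (1ℤ * Δ)) - r * ((Δ * 1ℤ - r * g i i) * Δ)
            ≡⟨ cong (λ m → Δ * (Δ * total - r * (1ℤ * Δ)) - r * ((Δ * 1ℤ - r * m) * Δ)) (g-diagonal i) ⟩
          Δ * (Δ * total - r * (1ℤ * Δ)) - r * ((Δ * 1ℤ - r * minor i) * Δ)
            ≡⟨ collect Δ total r (minor i) ⟩
          Δ * Δ * (total - + 2 * r) + r * r * (minor i * Δ)        ∎
          where
          collect : ∀ x t r m → x * (x * t - r * (1ℤ * x)) - r * ((x * 1ℤ - r * m) * x)
                              ≡ x * x * (t - + 2 * r) + r * r * (m * x)
          collect = solve-∀
          y-ones : y · (A ⊛ ones) ≡ Δ * total - r * (1ℤ * Δ)
          y-ones = trans (·-linearˡ Δ r (A ⊛ ones) ones (g i))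
            (cong₂ (λ s t → Δ * s - r * t)
              (trans (∑-cong λ k → ℤₚ.*-identityˡ _) (∑-cong A-ones))
              (trans (⊛-self-adjoint A symmetric (g i) ones) (form-A-g i ones)))

    -- The nonpositive value of the form at `y`, divided by D = `signedDet A`. For r = `rowSum i` ≠
    -- 0 a further division by r² D gives G / D ≥ R / r² - 2 / r, with G the signed minor and R the
    -- total.
    minor-bound : 0ℤ < signedDet A → ∀ i →
                  signedDet A * (total - + 2 * rowSum i) ≤ rowSum i * rowSum i * signedMinor i
    minor-bound 0<D i = nonneg-difference (*-cancel-nonneg 0<D
      (subst (0ℤ ≤_) identity (ℤₚ.neg-mono-≤ (subst (_≤ 0ℤ) (form-y i) (orthogonal⇒nonpositive (y i) i (A-y-i i))))))
      where
      ri = rowSum i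
      G = signedMinor i
      D = signedDet A
      expand : ∀ d² t r m → - (d² * (t - + 2 * r) + r * r * m) ≡ r * r * (- m) - d² * (t - + 2 * r)
      expand = solve-∀
      factor : ∀ d t r G → r * r * (G * d) - d * d * (t - + 2 * r) ≡ d * (r * r * G - d * (t - + 2 * r))
      factor = solve-∀
      identity : - (Δ * Δ * (total - + 2 * ri) + ri * ri * (minor i * Δ)) ≡ D * (ri * ri * G - D * (total - + 2 * ri))
      identity = begin
        - (Δ * Δ * (total - + 2 * ri) + ri * ri * (minor i * Δ))    ≡⟨ expand (Δ * Δ) total ri (minor i * Δ) ⟩
        ri * ri * (- (minor i * Δ)) - Δ * Δ * (total - + 2 * ri)
          ≡⟨ cong₂ (λ p q → ri * ri * p - q * (total - + 2 * ri)) (signed-product i) signed-square ⟨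
        ri * ri * (G * D) - D * D * (total - + 2 * ri)              ≡⟨ factor D total ri G ⟩
        D * (ri * ri * G - D * (total - + 2 * ri))                  ∎

  -- Growth of the coefficients

  -- The tangent to R/r² - 2/r at the mean value r = R/m, which replaces the
  -- hypothesis by a bound that is linear in r and can be summed over the rows.
  tangent-bound : ∀ m {D R r G} → 0ℤ ≤ m - 1ℤ → 0ℤ < D → 0ℤ < R → 0ℤ < r → D * (R - + 2 * r) ≤ r * r * G →
                  D * (m * (+ 3 * m - + 4) * R) + D * (- (+ 2 * (m - 1ℤ) * m * m)) * r ≤ R * R * G
  tangent-bound m {D} {R} {r} {G} 0≤m-1 0<D 0<R 0<r bound = nonneg-difference (*-cancel-nonneg (*-positive 0<r 0<r)
    (subst (0ℤ ≤_) (sym (identity D R r G m)) (ℤₚ.+-mono-≤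
      (*-nonneg (*-nonneg (ℤₚ.<⇒≤ 0<R) (ℤₚ.<⇒≤ 0<R)) (ℤₚ.i≤j⇒0≤j-i bound))
      (*-nonneg (ℤₚ.<⇒≤ 0<D) 0≤cubic))))
    where
    -- The gap between the function and its tangent, cleared of denominators: a double zero at m r =
    -- R, times a linear factor that is positive for r > 0.
    identity : ∀ D R r G m →
      r * r * (R * R * G - (D * (m * (+ 3 * m - + 4) * R) + D * (- (+ 2 * (m - 1ℤ) * m * m)) * r))
        ≡ R * R * (r * r * G - D * (R - + 2 * r)) + D * ((m * r - R) * (m * r - R) * (+ 2 * (m - 1ℤ) * r + R))
    identity = solve-∀
    0≤cubic : 0ℤ ≤ (m * r - R) * (m * r - R) * (+ 2 * (m - 1ℤ) * r + R)
    0≤cubic = *-nonneg (square-nonneg (m * r - R))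
      (ℤₚ.+-mono-≤ (*-nonneg (*-nonneg {+ 2} (+≤+ ℕ.z≤n) 0≤m-1) (ℤₚ.<⇒≤ 0<r)) (ℤₚ.<⇒≤ 0<R))

  ∑-positive : ∀ {n} {f : Fin (suc n) → ℤ} → (∀ i → 0ℤ < f i) → 0ℤ < ∑ f
  ∑-positive {f = f} 0<f = ℤₚ.<-≤-trans (0<f zero) (∑-term≤ {f = f} (λ i → ℤₚ.<⇒≤ (0<f i)) zero)

  *-cancel-positive : ∀ {p x} → 0ℤ < p → 0ℤ < p * x → 0ℤ < x
  *-cancel-positive {p} {x} 0<p 0<px = ℤₚ.*-cancelˡ-<-nonNeg p {{nonNegative (ℤₚ.<⇒≤ 0<p)}} (subst (_< p * x) (sym (ℤₚ.*-zeroʳ p)) 0<px)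

  *-cancel-≤ : ∀ {p x y} → 0ℤ < p → p * x ≤ p * y → x ≤ y
  *-cancel-≤ {p} {x} {y} 0<p = ℤₚ.*-cancelˡ-≤-pos x y p {{positive 0<p}}

  module TraceBound {n} {A : Matrix ℤ (suc (suc n))} (hollow : Hollow A) (d : ℤ)
    (off-diagonal-positive : ∀ i j → i ≢ j → 0ℤ < A i j) (bounded : ∀ i j → A i j ≤ d)
    (0<D : 0ℤ < signedDet A) where
    open Hollow hollow
    open Minors hollow

    private
      m = + (2 ℕ.+ n)
      R = total
      D = signedDet A
      G = signedMinor

      0<m : 0ℤ < m
      0<m = +<+ (ℕ.s≤s ℕ.z≤n)

      entry-nonneg : ∀ i j → 0ℤ ≤ A i j
      entry-nonneg i j with i ≟ j
      ... | yes refl = ℤₚ.≤-reflexive (sym (diagonal i))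
      ... | no  i≢j  = ℤₚ.<⇒≤ (off-diagonal-positive i j i≢j)

      rowSum-positive : ∀ i → 0ℤ < rowSum i
      rowSum-positive i = ℤₚ.<-≤-trans
        (off-diagonal-positive i (punchIn i zero) (punchInᵢ≢i i zero ∘ sym))
        (∑-term≤ {f = A i} (entry-nonneg i) (punchIn i zero))

      0<R : 0ℤ < R
      0<R = ∑-positive {f = rowSum} rowSum-positive

      R≤ : R ≤ m * (m * d)
      R≤ = ℤₚ.≤-trans (∑-mono {f = rowSum} {g = λ _ → m * d} λ i →
          ℤₚ.≤-trans (∑-mono {f = A i} {g = λ _ → d} (bounded i)) (ℤₚ.≤-reflexive (∑-const (2 ℕ.+ n) d)))
        (ℤₚ.≤-reflexive (∑-const (2 ℕ.+ n) (m * d)))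

      -- Summation multiplies the constant terms by m and turns r into R in the linear ones: m² (3 m
      -- - 4) - 2 m² (m - 1) = m² (m - 2).
      summed : R * (m * m * ((m - + 2) * D)) ≤ R * (R * ∑ G)
      summed = begin
        R * (m * m * ((m - + 2) * D))                       ≡⟨ collect D R m ⟨
        m * a + b * R                                       ≡⟨ cong₂ _+_ (∑-const (2 ℕ.+ n) a) (∑-*ˡ b rowSum) ⟨
        ∑ {2 ℕ.+ n} (λ _ → a) + ∑ (λ i → b * rowSum i)      ≡⟨ ∑-+ (λ _ → a) (λ i → b * rowSum i) ⟨
        ∑ (λ i → a + b * rowSum i)
          ≤⟨ ∑-mono {f = λ i → a + b * rowSum i} {g = λ i → R * R * G i} (λ i →
               tangent-bound m {D} {R} {rowSum i} {G i} (+≤+ ℕ.z≤n) 0<D 0<R (rowSum-positive i) (minor-bound 0<D i)) ⟩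
        ∑ (λ i → R * R * G i)                               ≡⟨ ∑-*ˡ (R * R) G ⟩
        R * R * ∑ G                                         ≡⟨ ℤₚ.*-assoc R R (∑ G) ⟩
        R * (R * ∑ G)                                       ∎
        where
        open ℤₚ.≤-Reasoning
        a = D * (m * (+ 3 * m - + 4) * R)
        b = D * (- (+ 2 * (m - 1ℤ) * m * m))
        collect : ∀ D R m → m * (D * (m * (+ 3 * m - + 4) * R)) + D * (- (+ 2 * (m - 1ℤ) * m * m)) * R
                          ≡ R * (m * m * ((m - + 2) * D))
        collect = solve-∀

    -- `summed` amounts to Σ G ≥ m² (m - 2) D / R, and R ≤ m² d. Here `n` is m - 2.
    trace-bound : (∀ i → 0ℤ ≤ G i) → + n * D ≤ d * ∑ G
    trace-bound 0≤G = *-cancel-≤ (*-positive 0<m 0<m) (begin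
      m * m * (+ n * D)            ≡⟨ cong (λ p → m * m * (p * D)) (shift-two (+ n)) ⟩
      m * m * ((m - + 2) * D)      ≤⟨ *-cancel-≤ 0<R summed ⟩
      R * ∑ G                      ≤⟨ ℤₚ.*-monoʳ-≤-nonNeg (∑ G) {{nonNegative (∑-nonneg 0≤G)}} R≤ ⟩
      m * (m * d) * ∑ G            ≡⟨ regroup m d (∑ G) ⟩
      m * m * (d * ∑ G)            ∎)
      where
      open ℤₚ.≤-Reasoning
      shift-two : ∀ x → x ≡ (+ 2 + x) - + 2
      shift-two = solve-∀
      regroup : ∀ m d g → m * (m * d) * g ≡ m * m * (d * g)
      regroup = solve-∀

  det₂ : (A : Matrix ℤ 2) → ℤ-Det.Det A ≡ A zero zero * A (suc zero) (suc zero) - A zero (suc zero) * A (suc zero) zero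
  det₂ A = trans (ℤ-Det.Det≡det A) (expand (A zero zero) (A zero (suc zero)) (A (suc zero) zero) (A (suc zero) (suc zero)))
    where
    expand : ∀ a b c e → a * (e * 1ℤ + 0ℤ) + (- (b * (c * 1ℤ + 0ℤ)) + 0ℤ) ≡ a * e - b * c
    expand = solve-∀

  -- Signed coefficients of principal submatrices

  module TreeCoefficients {n : ℕ} (T : Tree n) {d : ℕ} (isDiameter : IsDiameter (Tree.graph T) d) where
    open TreeDistance T
    open TreeForm T

    Inj : ∀ {m} → (Fin m → Fin n) → Set
    Inj σ = ∀ {k l} → σ k ≡ σ l → k ≡ l

    punchIn-Inj : ∀ {m} {σ : Fin (suc m) → Fin n} → Inj σ → ∀ i → Inj (σ ∘ punchIn i)
    punchIn-Inj σ-inj i eq = punchIn-injective i _ _ (σ-inj eq)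

    -- Deleting index i is composition of `σ` with `punchIn i`. The sign does not involve k: the
    -- coefficient of x^k is (-1)^k times the sum of the minors of size m - k, and (-1)^k ε (m - k)
    -- = ε m.
    signedCoeff : ∀ {m} → ℕ → (Fin m → Fin n) → ℤ
    signedCoeff {m} k σ = ε m * coeff (charPoly (submatrix σ)) k

    signedCoeff-zero : ∀ {m} (σ : Fin m → Fin n) → signedCoeff 0 σ ≡ signedDet (submatrix σ)
    signedCoeff-zero {m} σ = cong (ε m *_) (charPoly-zero (submatrix σ))

    -- The minus sign of `charPoly-suc` is absorbed by ε (m + 1) = -ε m.
    signedCoeff-suc : ∀ {m} k (σ : Fin (suc m) → Fin n) → + suc k * signedCoeff (suc k) σ ≡ ∑ λ i → signedCoeff k (σ ∘ punchIn i)
    signedCoeff-suc {m} k σ = begin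
      + suc k * (- ε m * coeff (charPoly (submatrix σ)) (suc k))    ≡⟨ regroup (+ suc k) (ε m) _ ⟩
      - ε m * (+ suc k * coeff (charPoly (submatrix σ)) (suc k))    ≡⟨ cong (- ε m *_) (charPoly-suc (submatrix σ) k) ⟩
      - ε m * - _                                                   ≡⟨ cong (λ s → - ε m * - s) (sym (∑≡sum minor)) ⟩
      - ε m * - ∑ minor                                             ≡⟨ cancel (ε m) (∑ minor) ⟩
      ε m * ∑ minor                                                 ≡⟨ ∑-*ˡ (ε m) minor ⟨
      ∑ (λ i → ε m * minor i)                                       ∎
      where
      open ≡-Reasoning
      minor : Fin (suc m) → ℤ
      minor i = coeff (charPoly (submatrix (σ ∘ punchIn i))) k
      regroup : ∀ a e x → a * (- e * x) ≡ - e * (a * x)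
      regroup = solve-∀
      cancel : ∀ e s → - e * - s ≡ e * s
      cancel = solve-∀

    hollow : ∀ {m} {σ : Fin m → Fin n} → Inj σ → Hollow (submatrix σ)
    hollow {σ = σ} σ-inj = record
      { symmetric   = λ k l → cong +_ (D-sym (σ k) (σ l))
      ; diagonal    = λ k → cong +_ (D-refl (σ k))
      ; strictlyCND = submatrix-cnd σ σ-inj
      }

    off-diagonal-positive : ∀ {m} {σ : Fin m → Fin n} → Inj σ → ∀ k l → k ≢ l → 0ℤ < submatrix σ k l
    off-diagonal-positive σ-inj k l k≢l = +<+ (D-positive (k≢l ∘ σ-inj))

    -- The induction starts at size 2, because minors of size 1 are zero diagonal entries; there the
    -- determinant is minus the product of two positive distances, and ε 2 = -1.
    signedDet-submatrix-positive : ∀ m {σ : Fin (2 ℕ.+ m) → Fin n} → Inj σ → 0ℤ < signedDet (submatrix σ)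
    signedDet-submatrix-positive zero {σ} σ-inj = subst (0ℤ <_) (sym eq)
      (*-positive (off-diagonal-positive σ-inj zero (suc zero) λ ()) (off-diagonal-positive σ-inj (suc zero) zero λ ()))
      where
      A = submatrix σ
      expand : ∀ a b → -1ℤ * (0ℤ * 0ℤ - a * b) ≡ a * b
      expand = solve-∀
      eq : signedDet A ≡ A zero (suc zero) * A (suc zero) zero
      eq = trans (cong (-1ℤ *_) (trans (det₂ A)
             (cong₂ (λ x y → x * y - A zero (suc zero) * A (suc zero) zero)
               (Hollow.diagonal (hollow σ-inj) zero) (Hollow.diagonal (hollow σ-inj) (suc zero)))))
           (expand (A zero (suc zero)) (A (suc zero) zero))
    signedDet-submatrix-positive (suc m) {σ} σ-inj = Minors.signedDet-positive (hollow σ-inj) zero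
      (signedDet-submatrix-positive m (punchIn-Inj {σ = σ} σ-inj zero))

    -- The recursion over deleted indices ends at determinants of size m + 2, which is where
    -- positivity is known.
    signedCoeff-positive : ∀ k m {σ : Fin (k ℕ.+ (2 ℕ.+ m)) → Fin n} → Inj σ → 0ℤ < signedCoeff k σ
    signedCoeff-positive zero    m {σ} σ-inj = subst (0ℤ <_) (sym (signedCoeff-zero σ)) (signedDet-submatrix-positive m σ-inj)
    signedCoeff-positive (suc k) m {σ} σ-inj = *-cancel-positive {+ suc k} (+<+ (ℕ.s≤s ℕ.z≤n)) (subst (0ℤ <_) (sym (signedCoeff-suc k σ))
      (∑-positive {f = λ i → signedCoeff k (σ ∘ punchIn i)} λ i → signedCoeff-positive k m (punchIn-Inj {σ = σ} σ-inj i)))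

    -- For k = 0 this is the trace bound at size m + 3. In the step the inequality is summed over
    -- the deleted index; `signedCoeff-suc` turns each side into k + 1 times the wanted one, while
    -- size and k drop together and leave m + 1 unchanged.
    signedCoeff-growth : ∀ k m {σ : Fin (k ℕ.+ (3 ℕ.+ m)) → Fin n} → Inj σ →
               + suc m * signedCoeff k σ ≤ + d * (+ suc k * signedCoeff (suc k) σ)
    signedCoeff-growth zero m {σ} σ-inj = begin
      + suc m * signedCoeff 0 σ                        ≡⟨ cong (+ suc m *_) (signedCoeff-zero σ) ⟩
      + suc m * signedDet (submatrix σ)      ≤⟨ TraceBound.trace-bound (hollow σ-inj) (+ d)
                                                  (off-diagonal-positive σ-inj) (λ i j → +≤+ (D-bounded isDiameter (σ i) (σ j)))
                                                  (signedDet-submatrix-positive (suc m) σ-inj)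
                                                  (λ i → ℤₚ.<⇒≤ (signedDet-submatrix-positive m (punchIn-Inj {σ = σ} σ-inj i))) ⟩
      + d * ∑ (λ i → signedDet (submatrix (σ ∘ punchIn i)))
        ≡⟨ cong (+ d *_) (trans (signedCoeff-suc 0 σ) (∑-cong λ i → signedCoeff-zero (σ ∘ punchIn i))) ⟨
      + d * (1ℤ * signedCoeff 1 σ)                     ∎
      where open ℤₚ.≤-Reasoning
    signedCoeff-growth (suc k) m {σ} σ-inj = *-cancel-≤ {+ suc k} (+<+ (ℕ.s≤s ℕ.z≤n)) (begin
      + suc k * (+ suc m * signedCoeff (suc k) σ)                   ≡⟨ exchange (+ suc k) (+ suc m) (signedCoeff (suc k) σ) ⟩
      + suc m * (+ suc k * signedCoeff (suc k) σ)                   ≡⟨ cong (+ suc m *_) (signedCoeff-suc k σ) ⟩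
      + suc m * ∑ (λ i → signedCoeff k (σ ∘ punchIn i))             ≡⟨ ∑-*ˡ (+ suc m) (λ i → signedCoeff k (σ ∘ punchIn i)) ⟨
      ∑ (λ i → + suc m * signedCoeff k (σ ∘ punchIn i))
        ≤⟨ ∑-mono {f = λ i → + suc m * signedCoeff k (σ ∘ punchIn i)} {g = λ i → + d * (+ suc k * signedCoeff (suc k) (σ ∘ punchIn i))}
             (λ i → signedCoeff-growth k m (punchIn-Inj {σ = σ} σ-inj i)) ⟩
      ∑ (λ i → + d * (+ suc k * signedCoeff (suc k) (σ ∘ punchIn i)))
        ≡⟨ trans (∑-*ˡ (+ d) (λ i → + suc k * signedCoeff (suc k) (σ ∘ punchIn i))) (cong (+ d *_) (∑-*ˡ (+ suc k) (λ i → signedCoeff (suc k) (σ ∘ punchIn i)))) ⟩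
      + d * (+ suc k * ∑ (λ i → signedCoeff (suc k) (σ ∘ punchIn i)))
        ≡⟨ cong (λ s → + d * (+ suc k * s)) (signedCoeff-suc (suc k) σ) ⟨
      + d * (+ suc k * (+ suc (suc k) * signedCoeff (suc (suc k)) σ))
        ≡⟨ exchange (+ d) (+ suc k) (+ suc (suc k) * signedCoeff (suc (suc k)) σ) ⟩
      + suc k * (+ d * (+ suc (suc k) * signedCoeff (suc (suc k)) σ))  ∎)
      where
      open ℤₚ.≤-Reasoning
      exchange : ∀ a b x → a * (b * x) ≡ b * (a * x)
      exchange = solve-∀

    -- Writing c for the signed coefficient at k, the growth bound and d (k + 1) ≤ m would give 2 (m
    -- + 1) c ≤ m c, impossible for c > 0.
    signedCoeff-nonincreasing-absurd : ∀ {N} k m {σ : Fin N → Fin n} → Inj σ → N ≡ k ℕ.+ (3 ℕ.+ m) → d ℕ.* suc k ℕ.≤ m →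
                             ¬ (+ 2 * signedCoeff (suc k) σ ≤ signedCoeff k σ)
    signedCoeff-nonincreasing-absurd k m {σ} σ-inj refl dk≤m 2c′≤c = ℤₚ.<⇒≱ (*-positive {+ 2 + + m} (+<+ (ℕ.s≤s ℕ.z≤n)) 0<c)
      (subst (_≤ 0ℤ) (balance (+ m) (signedCoeff k σ)) (ℤₚ.i≤j⇒i-j≤0 chain))
      where
      open ℤₚ.≤-Reasoning
      0<c : 0ℤ < signedCoeff k σ
      0<c = signedCoeff-positive k (suc m) σ-inj
      exchange : ∀ a b x → + 2 * (a * (b * x)) ≡ a * b * (+ 2 * x)
      exchange = solve-∀
      balance : ∀ m x → + 2 * ((1ℤ + m) * x) - m * x ≡ (+ 2 + m) * x
      balance = solve-∀
      chain : + 2 * (+ suc m * signedCoeff k σ) ≤ + m * signedCoeff k σ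
      chain = begin
        + 2 * (+ suc m * signedCoeff k σ)                     ≤⟨ ℤₚ.*-monoˡ-≤-nonNeg (+ 2) (signedCoeff-growth k m σ-inj) ⟩
        + 2 * (+ d * (+ suc k * signedCoeff (suc k) σ))       ≡⟨ exchange (+ d) (+ suc k) (signedCoeff (suc k) σ) ⟩
        + d * + suc k * (+ 2 * signedCoeff (suc k) σ)         ≡⟨ cong (_* (+ 2 * signedCoeff (suc k) σ)) (ℤₚ.pos-* d (suc k)) ⟨
        + (d ℕ.* suc k) * (+ 2 * signedCoeff (suc k) σ)       ≤⟨ ℤₚ.*-monoˡ-≤-nonNeg (+ (d ℕ.* suc k)) 2c′≤c ⟩
        + (d ℕ.* suc k) * signedCoeff k σ                     ≤⟨ ℤₚ.*-monoʳ-≤-nonNeg (signedCoeff k σ) {{nonNegative (ℤₚ.<⇒≤ 0<c)}} (+≤+ dk≤m) ⟩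
        + m * signedCoeff k σ                                 ∎

  -- From coefficients to the peak location

  /-cancel-≤ : ∀ a b n .{{_ : ℕ.NonZero n}} → (+ a) ℚ./ n ℚ.≤ (+ b) ℚ./ n → a ℕ.≤ b
  -- Since `ℚ./` reduces to lowest terms, the comparison passes through unnormalised fractions,
  -- which keep the common denominator.
  /-cancel-≤ a b n@(suc n-1) a/n≤b/n = ℕₚ.*-cancelʳ-≤ a b n (ℤₚ.drop‿+≤+
    (subst₂ _≤_ (sym (ℤₚ.pos-* a n)) (sym (ℤₚ.pos-* b n)) (ℚᵘₚ.drop-*≤* (begin
      ℚᵘ.mkℚᵘ (+ a) n-1                      ≃⟨ ℚₚ.toℚᵘ-fromℚᵘ (ℚᵘ.mkℚᵘ (+ a) n-1) ⟨
      ℚ.toℚᵘ ((+ a) ℚ./ n)                   ≤⟨ ℚₚ.toℚᵘ-mono-≤ a/n≤b/n ⟩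
      ℚ.toℚᵘ ((+ b) ℚ./ n)                   ≃⟨ ℚₚ.toℚᵘ-fromℚᵘ (ℚᵘ.mkℚᵘ (+ b) n-1) ⟩
      ℚᵘ.mkℚᵘ (+ b) n-1                      ∎))))
    where open ℚᵘₚ.≤-Reasoning

  module _ {n : ℕ} (T : Tree n) {d : ℕ} (isDiameter : IsDiameter (Tree.graph T) d) where
    open TreeDistance T
    open TreeForm T
    open TreeCoefficients T isDiameter

    charPoly-submatrix : ∀ k → coeff (charPoly (submatrix id)) k ≡ δ T k
    charPoly-submatrix k = charPoly-cong (λ i j → cong +_ (D≡distance i j)) k

    ∣δ∣≡signedCoeff : ∀ k m → n ≡ k ℕ.+ (2 ℕ.+ m) → + ∣ δ T k ∣ ≡ signedCoeff k (id {A = Fin n})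
    ∣δ∣≡signedCoeff k m n≡ = begin
      + ∣ δ T k ∣                              ≡⟨ cong (λ x → + ∣ x ∣) (charPoly-submatrix k) ⟨
      + ∣ coeff (charPoly (submatrix id)) k ∣  ≡⟨ cong +_ (∣ε∣ n (coeff (charPoly (submatrix id)) k)) ⟨
      + ∣ signedCoeff k (id {A = Fin n}) ∣               ≡⟨ ℤₚ.0≤i⇒+∣i∣≡i (ℤₚ.<⇒≤ (positive-at id id n≡)) ⟩
      signedCoeff k (id {A = Fin n})                     ∎
      where
      open ≡-Reasoning
      ∣ε∣ : ∀ n x → ∣ ε n * x ∣ ≡ ∣ x ∣
      ∣ε∣ zero    x = trans (cong ∣_∣ (ℤₚ.-1*i≡-i x)) (ℤₚ.∣-i∣≡∣i∣ x)
      ∣ε∣ (suc n) x = trans (cong ∣_∣ (sym (ℤₚ.neg-distribˡ-* (ε n) x))) (trans (ℤₚ.∣-i∣≡∣i∣ (ε n * x)) (∣ε∣ n x))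
      -- The size `N` is separated from the parameter `n` of the tree so that the equation can be
      -- matched.
      positive-at : ∀ {N} (σ : Fin N → Fin n) → Inj σ → N ≡ k ℕ.+ (2 ℕ.+ m) → 0ℤ < signedCoeff k σ
      positive-at σ σ-inj refl = signedCoeff-positive k m σ-inj

  -- At a peak k the sequence does not rise from k to k + 1, so 2 |δₖ₊₁| ≤ |δₖ|; below the claimed
  -- bound the growth of the coefficients excludes this.
  peak-bound : ∀ n → 3 ℕ.≤ n → (T : Tree n) → ∀ d → IsDiameter (Tree.graph T) d →
               ∀ k → IsPeak (normalizedCoeffs T) k → (n ∸ 2) ℕ./ (1 ℕ.+ d) ℕ.≤ toℕ k
  peak-bound (suc (suc m)) (ℕ.s≤s (ℕ.s≤s _)) T d isDiameter k (_ , decreasing) = ℕₚ.≮⇒≥ peak-too-small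
    where
    open TreeCoefficients T isDiameter
    κ = toℕ k

    peak-too-small : ¬ (κ ℕ.< m ℕ./ (1 ℕ.+ d))
    peak-too-small κ< = signedCoeff-nonincreasing-absurd κ (m ∸ suc κ) id size small (subst₂ _≤_
        (trans (ℤₚ.pos-* 2 ∣ δ T (suc κ) ∣) (cong (+ 2 *_) (∣δ∣≡signedCoeff T isDiameter (suc κ) (m ∸ suc κ) (trans size (ℕₚ.+-suc κ (2 ℕ.+ (m ∸ suc κ)))))))
        (∣δ∣≡signedCoeff T isDiameter κ (suc (m ∸ suc κ)) size)
        (+≤+ 2δ′≤δ))
      where
      -- With m = n - 2, k + 1 is at most the floor of m / (1 + d), and multiplying back loses only
      -- the remainder.
      block : suc κ ℕ.* (1 ℕ.+ d) ℕ.≤ m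
      block = ℕₚ.≤-trans (ℕₚ.*-monoˡ-≤ (1 ℕ.+ d) κ<) (ℕ.m/n*n≤m m (1 ℕ.+ d))

      κ<m : κ ℕ.< m
      κ<m = ℕₚ.≤-trans (ℕₚ.m≤m*n (suc κ) (1 ℕ.+ d)) block

      m≡ : m ≡ suc κ ℕ.+ (m ∸ suc κ)
      m≡ = sym (ℕₚ.m+[n∸m]≡n κ<m)

      size : 2 ℕ.+ m ≡ κ ℕ.+ (3 ℕ.+ (m ∸ suc κ))
      size = trans (cong (2 ℕ.+_) m≡) (rearrange κ (m ∸ suc κ))
        where
        rearrange : ∀ κ e → 2 ℕ.+ (suc κ ℕ.+ e) ≡ κ ℕ.+ (3 ℕ.+ e)
        rearrange = solve-∀ℕ

      small : d ℕ.* suc κ ℕ.≤ m ∸ suc κ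
      small = ℕₚ.+-cancelˡ-≤ (suc κ) _ _ (ℕₚ.≤-trans (ℕₚ.≤-reflexive (rearrange d (suc κ)))
        (ℕₚ.≤-trans block (ℕₚ.≤-reflexive m≡)))
        where
        rearrange : ∀ d κ → κ ℕ.+ d ℕ.* κ ≡ κ ℕ.* (1 ℕ.+ d)
        rearrange = solve-∀ℕ

      i : Fin m
      i = fromℕ< κ<m

      toℕ-i : toℕ i ≡ κ
      toℕ-i = toℕ-fromℕ< κ<m

      toℕ-i′ : toℕ (inject₁ i) ≡ κ
      toℕ-i′ = trans (toℕ-inject₁ i) toℕ-i

      weighted : ℕ → ℕ
      weighted j = 2 ^ j ℕ.* ∣ δ T j ∣

      weighted-≤ : weighted (suc κ) ℕ.≤ weighted κ
      weighted-≤ = subst₂ (λ x y → weighted x ℕ.≤ weighted y) (cong suc toℕ-i) toℕ-i′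
        (/-cancel-≤ (weighted (toℕ (Fin.suc i))) (weighted (toℕ (inject₁ i))) (2 ^ m) {{ℕₚ.m^n≢0 2 m}} (decreasing i (ℕₚ.≤-reflexive (sym toℕ-i′))))

      -- The weights 2^(k+1) and 2^k share the factor 2^k; the remaining 2 is the one in the growth
      -- argument.
      2δ′≤δ : 2 ℕ.* ∣ δ T (suc κ) ∣ ℕ.≤ ∣ δ T κ ∣
      2δ′≤δ = ℕₚ.*-cancelˡ-≤ (2 ^ κ) {{ℕₚ.m^n≢0 2 κ}} (subst (ℕ._≤ weighted κ)
        (rearrange (2 ^ κ) ∣ δ T (suc κ) ∣) weighted-≤)
        where
        rearrange : ∀ p x → 2 ℕ.* p ℕ.* x ≡ p ℕ.* (2 ℕ.* x)
        rearrange = solve-∀ℕ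

open import Data.Nat.Base using (_+_; _≤_; _/_)

theorem3p6 : ∀ (n : ℕ) → 3 ≤ n → (T : Tree n) → (d : ℕ) → IsDiameter (Tree.graph T) d →
    ∀ (k : Fin (suc (n ∸ 2))) → IsPeak (normalizedCoeffs T) k →
    (n ∸ 2) / (1 + d) ≤ toℕ k
theorem3p6 = peak-bound
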